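{- The pattern subgroup $U_{P_\diamond}(q)$ of $U_{13}(q)$ embeds into $U_{59}(q)$; that is, the 13-element poset $P_\diamond$ embeds into the chain $\mathcal{C}^{59}$ (in symbols $P_\diamond\rightsquigarrow\mathcal{C}^{59}$).
   Context: All posets are finite. $\mathcal{C}^n$ is the $n$-element chain. For $x$ in a poset $P$, $\mathrm{lb}(x)=\{y\in P: y\prec x\}$; $\max(P)$ is the set of maximal elements; $\mathrm{ac}(X)$ is the set of antichains contained in $X$ (including $\varnothing$). The poset $P_\diamond$ has 13 elements: minimal elements $b_1,b_2,b_3,b_4$; middle elements $c_{12},c_{13},c_{14},c_{23},c_{24},c_{34}$; maximal elements $t_1,t_2,t_3$. Its cover relations are: $b_i\prec c_{ij}$ and $b_j\prec c_{ij}$ for all $1\le i<j\le 4$; $c_{13},c_{14},c_{23},c_{24}\prec t_1$; $c_{12},c_{14},c_{23},c_{34}\prec t_2$; $c_{12},c_{13},c_{24},c_{34}\prec t_3$. Pattern groups. For a poset $P$, label its elements by $1,\dots,n$ so that $i\preceq_P j$ implies $i\le j$ (the quantities below do not depend on the labelling). Let $e_{i,j}$ be the matrix units of $M_{n\times n}(\mathbb{F}_q)$. Put $\mathcal{U}_P(q)=\{X\in M_{n\times n}(\mathbb{F}_q): X_{i,j}=0\text{ if }i\not\prec_P j\}$, $U_P(q)=\{1+X:X\in\mathcal{U}_P(q)\}$, and let $k(P)=k(U_P(q))$ be the number of conjugacy classes of $U_P(q)$, as a function of the prime power $q$. Thus $U_{\mathcal{C}^n}(q)=U_n(q)$, the group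 of unitriangular $n\times n$ matrices over $\mathbb{F}_q$. Let $\mathcal{L}_P(q)=M_{n\times n}(\mathbb{F}_q)/\bigoplus_{i\not\succ_P j}\mathbb{F}_q e_{i,j}$. The group $U_P(q)$ acts on $\mathcal{L}_P(q)$ by the co-adjoint action $K_g(L)=gLg^{ -1}$ (conjugate any matrix representative and project back). Poset systems. A poset system is a triple $S=(P,m,A)$ with $P$ a poset, $m\in\max(P)$, and $A\in\mathrm{ac}(\mathrm{lb}(m))$. Let $Q=P^{(m)}$ be the poset on the ground set of $P$ whose only relations are $x\prec m$ for $x\prec_P m$, and let $\pi:\mathcal{L}_P\to\mathcal{L}_Q$ be the canonical projection, killing all $e_{i,j}$ not of the form $e_{m,x}$ with $x\prec_P m$. Then $U_P$ acts on $\mathcal{L}_Q$ through $\pi$. With $1_A=\sum_{a\in A}e_{m,a}\in\mathcal{L}_Q$, let $k(S)=k(P,m,A)$ be the number of orbits of $\mathrm{stab}_{U_P}(1_A)$ on $\pi^{ -1}(1_A)$, as a function of $q$. Embedding. A poset $P$ embeds into a poset $Q$, written $P\rightsquigarrow Q$, if there exist posets $P_0,P_1,\dots,P_n$ and poset systems $S_1,\dots,S_n$ with $S_i=(P_i,m_i,A_i)$ such that $P_0=P$, $P_n=Q$, and $k(P_i)=k(S_{i+1})$ (as functions of $q$) for $0\le i<n$. Posets are considered up to isomorphism. -}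

module Defs where

open import Algebra.Bundles using (CommutativeRing)
open import Algebra.Structures using (IsCommutativeRing)
import Algebra.Properties.CommutativeMonoid.Sum as Sum
open import Data.Bool.Base using (if_then_else_)
open import Data.Empty using (⊥-elim)
open import Data.Fin.Base using (Fin; zero; suc; toℕ; inject₁; fromℕ; finToFun; funToFin)
import Data.Fin.Base as Fin
open import Data.Fin.Patterns
import Data.Fin.Properties as Fin
open import Data.Fin.Subset using (Subset; _∈_)
open import Data.Fin.Subset.Properties using (_∈?_)
open import Data.List.Base using (List; []; _∷_; length; filter; deduplicate; tabulate)
import Data.List.Membership.DecPropositional as ListMembership
open import Data.Nat.Base using (ℕ; zero; suc; _^_)
import Data.Nat.Properties as ℕ
open import Data.Product.Base using (Σ; Σ-syntax; ∃; ∃-syntax; _×_; _,_; proj₁; proj₂)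
open import Data.Product.Properties using (≡-dec)
open import Data.Sum.Base using (_⊎_; inj₁; inj₂)
open import Function.Bundles using (Func; Inverse; _↔_)
open import Function.Properties.Inverse using (↔⇒↣; ↔-sym)
open import Level using (0ℓ)
open import Relation.Binary.Bundles using (Setoid)
open import Relation.Binary.Core using (Rel)
open import Relation.Binary.Construct.Closure.ReflexiveTransitive using (Star; ε; _◅_; _◅◅_)
import Relation.Binary.Construct.NonStrictToStrict as NonStrictToStrict
open import Relation.Binary.Definitions using (DecidableEquality)
import Relation.Binary.Definitions as B
open import Relation.Binary.Morphism.Structures using (IsOrderIsomorphism)
open import Relation.Binary.PropositionalEquality
  using (_≡_; _≢_; refl; sym; trans; cong; cong₂; subst; isEquivalence)
open import Relation.Binary.Structures using (IsDecPartialOrder)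
open import Relation.Nullary.Decidable
  using (Dec; does; _×-dec_; _⊎-dec_; _→-dec_; ¬?; map′; via-injection; from-yes)
open import Relation.Nullary.Negation using (¬_)
open import Relation.Unary using (Pred; Decidable)

-- Elements are labelled arbitrarily by Fin size: matrices are indexed by
-- the elements of the poset, and choosing the labelling to be a linear
-- extension merely makes the pattern group upper triangular.
record FinPoset : Set₁ where
  infix 4 _≼_
  field
    size              : ℕ
    _≼_               : Rel (Fin size) 0ℓ
    isDecPartialOrder : IsDecPartialOrder _≡_ _≼_

  open IsDecPartialOrder isDecPartialOrder public
    using (antisym)
    renaming (refl to ≼-refl; trans to ≼-trans; _≤?_ to _≼?_)

  open NonStrictToStrict _≡_ _≼_ public
    using () renaming (_<_ to _≺_)

  infix 4 _≺?_
  _≺?_ : B.Decidable _≺_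
  _≺?_ = NonStrictToStrict.<-decidable _≡_ _≼_ Fin._≟_ _≼?_

infix 4 _≅_
_≅_ : FinPoset → FinPoset → Set
P ≅ Q = ∃[ f ] IsOrderIsomorphism _≡_ _≡_ (_≼_ P) (_≼_ Q) f
  where open FinPoset

chain : ℕ → FinPoset
chain n = record
  { size              = n
  ; _≼_               = Fin._≤_
  ; isDecPartialOrder = record
    { isPartialOrder = Fin.≤-isPartialOrder
    ; _≟_            = Fin._≟_
    ; _≤?_           = Fin._≤?_
    }
  }

module _ (P : FinPoset) where
  open FinPoset P

  _∈max : Fin size → Set
  m ∈max = ∀ x → m ≼ x → x ≡ m

  IsAntichain : Subset size → Set
  IsAntichain A = ∀ {x y} → x ∈ A → y ∈ A → x ≼ y → x ≡ y

  -- P^(m): its only strict relations are x ≺ m for x below m in P.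
  star : Fin size → FinPoset
  star m = record
    { size              = size
    ; _≼_               = _⊑_
    ; isDecPartialOrder = record
      { isPartialOrder = record
        { isPreorder = record
          { isEquivalence = isEquivalence
          ; reflexive     = inj₁
          ; trans         = ⊑-trans
          }
        ; antisym = ⊑-antisym
        }
      ; _≟_  = Fin._≟_
      ; _≤?_ = λ x y → (x Fin.≟ y) ⊎-dec ((y Fin.≟ m) ×-dec (x ≺? m))
      }
    }
    where
    _⊑_ : Rel (Fin size) 0ℓ
    x ⊑ y = x ≡ y ⊎ (y ≡ m × x ≺ m)

    ⊑-trans : B.Transitive _⊑_
    ⊑-trans (inj₁ refl) q                             = q
    ⊑-trans p           (inj₁ refl)                   = p
    ⊑-trans (inj₂ (refl , _)) (inj₂ (_ , (_ , m≢m))) = ⊥-elim (m≢m refl)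

    ⊑-antisym : B.Antisymmetric _≡_ _⊑_
    ⊑-antisym (inj₁ refl) _                              = refl
    ⊑-antisym (inj₂ _)    (inj₁ y≡x)                     = sym y≡x
    ⊑-antisym (inj₂ (refl , _)) (inj₂ (_ , (_ , m≢m))) = ⊥-elim (m≢m refl)

record PosetSystem (P : FinPoset) : Set where
  open FinPoset P
  field
    m           : Fin size
    m∈max       : _∈max P m
    A           : Subset size
    A⊆lb        : ∀ {x} → x ∈ A → x ≺ m
    isAntichain : IsAntichain P A

record FiniteField (q : ℕ) : Set₁ where
  infixl 7 _*_
  infixl 6 _+_
  infix  8 -_
  field
    Carrier           : Set
    _+_ _*_           : Carrier → Carrier → Carrier
    -_                : Carrier → Carrier
    0# 1#             : Carrier
    isCommutativeRing : IsCommutativeRing _≡_ _+_ _*_ -_ 0# 1#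
    0≢1               : 0# ≢ 1#
    invertible        : ∀ x → x ≢ 0# → ∃[ y ] x * y ≡ 1#
    enumeration       : Fin q ↔ Carrier

  commutativeRing : CommutativeRing 0ℓ 0ℓ
  commutativeRing = record { isCommutativeRing = isCommutativeRing }

  open CommutativeRing commutativeRing public
    using (_-_; +-commutativeMonoid)

  infix 4 _≟_
  _≟_ : DecidableEquality Carrier
  _≟_ = via-injection (↔⇒↣ (↔-sym enumeration)) Fin._≟_

module Matrices {q : ℕ} (F : FiniteField q) where
  open FiniteField F
  open Sum +-commutativeMonoid using (sum-syntax; sum-cong-≗)

  Matrix : ℕ → Set
  Matrix n = Fin n → Fin n → Carrier

  infix 4 _≈_
  _≈_ : ∀ {n} → Rel (Matrix n) 0ℓ
  M ≈ N = ∀ i j → M i j ≡ N i j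

  infixl 7 _·_
  _·_ : ∀ {n} → Matrix n → Matrix n → Matrix n
  _·_ {n} M N i j = ∑[ k < n ] (M i k * N k j)

  infixl 6 _⊖_
  _⊖_ : ∀ {n} → Matrix n → Matrix n → Matrix n
  (M ⊖ N) i j = M i j - N i j

  𝟙 : ∀ {n} → Matrix n
  𝟙 i j = if does (i Fin.≟ j) then 1# else 0#

  matrices : ∀ n → List (Matrix n)

  -- The number of classes of ∼ among the matrices satisfying a predicate
  -- In; ∼ is meant to be an equivalence relation on those matrices that
  -- contains pointwise equality. One representative of each class is
  -- retained and the representatives are counted.
  #classes : ∀ {n} {In : Pred (Matrix n) 0ℓ} {_∼_ : Rel (Matrix n) 0ℓ} →
             Decidable In → B.Decidable _∼_ → ℕ
  #classes {n} In? _∼?_ = length (deduplicate _∼?_ (filter In? (matrices n)))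

  decode : ∀ {n} → Fin ((q ^ n) ^ n) → Matrix n
  decode c i j = Inverse.to enumeration (finToFun (finToFun c i) j)

  encode : ∀ {n} → Matrix n → Fin ((q ^ n) ^ n)
  encode M = funToFin (λ i → funToFin (λ j → Inverse.from enumeration (M i j)))

  decode-encode : ∀ {n} (M : Matrix n) → M ≈ decode (encode M)
  decode-encode M i j = sym (trans
    (cong (λ c → Inverse.to enumeration (finToFun c j)) (Fin.finToFun-funToFin _ i))
    (trans (cong (Inverse.to enumeration) (Fin.finToFun-funToFin _ j))
           (Inverse.strictlyInverseˡ enumeration (M i j))))

  matrices n = tabulate {n = (q ^ n) ^ n} decode

  ≈-sym : ∀ {n} {M N : Matrix n} → M ≈ N → N ≈ M
  ≈-sym M≈N i j = sym (M≈N i j)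

  ≈-trans : ∀ {n} {L M N : Matrix n} → L ≈ M → M ≈ N → L ≈ N
  ≈-trans L≈M M≈N i j = trans (L≈M i j) (M≈N i j)

  ·-cong : ∀ {n} {M M′ N N′ : Matrix n} → M ≈ M′ → N ≈ N′ → M · N ≈ M′ · N′
  ·-cong M≈M′ N≈N′ i j = sum-cong-≗ (λ k → cong₂ _*_ (M≈M′ i k) (N≈N′ k j))

  infix 4 _≈?_
  _≈?_ : ∀ {n} → B.Decidable (_≈_ {n})
  M ≈? N = Fin.all? (λ i → Fin.all? (λ j → M i j ≟ N i j))

  anyMatrix? : ∀ {n} {Φ : Pred (Matrix n) 0ℓ} →
               (∀ {M N} → M ≈ N → Φ M → Φ N) → Decidable Φ → Dec (∃ Φ)
  anyMatrix? resp Φ? = map′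
    (λ (c , p) → decode c , p)
    (λ (M , p) → encode M , resp (decode-encode M) p)
    (Fin.any? (λ c → Φ? (decode c)))

module PatternGroup (P : FinPoset) {q : ℕ} (F : FiniteField q) where
  open FinPoset P
  open FiniteField F
  open Matrices F

  In𝒰 : Pred (Matrix size) 0ℓ
  In𝒰 X = ∀ i j → ¬ (i ≺ j) → X i j ≡ 0#

  InU : Pred (Matrix size) 0ℓ
  InU g = In𝒰 (g ⊖ 𝟙)

  -- Elements of U_P, packaged with their inverse. Every matrix in 1 + 𝒰_P
  -- is invertible (𝒰_P is nilpotent) and the inverse is unique, so the
  -- extra fields are no restriction and no extra data.
  record U : Set where
    field
      mat      : Matrix size
      inv      : Matrix size
      mat∈U    : InU mat
      inverseʳ : mat · inv ≈ 𝟙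
      inverseˡ : inv · mat ≈ 𝟙
  open U public

  conj : U → Matrix size → Matrix size
  conj g L = mat g · L · inv g

  -- ℒ_P: matrices modulo the span of the e_{i,j} with i ⊁ j, that is,
  -- up to agreement of the entries (i , j) with i ≻ j.
  ℒ : Setoid 0ℓ 0ℓ
  ℒ = record
    { Carrier       = Matrix size
    ; _≈_           = λ L L′ → ∀ i j → j ≺ i → L i j ≡ L′ i j
    ; isEquivalence = record
      { refl  = λ _ _ _ → refl
      ; sym   = λ p i j j≺i → sym (p i j j≺i)
      ; trans = λ p r i j j≺i → trans (p i j j≺i) (r i j j≺i)
      }
    }

  open Setoid ℒ public using () renaming (_≈_ to _≈ℒ_)

  K : U → Setoid.Carrier ℒ → Setoid.Carrier ℒ
  K = conj

  infix 4 _≈ℒ?_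
  _≈ℒ?_ : B.Decidable _≈ℒ_
  L ≈ℒ? L′ = Fin.all? (λ i → Fin.all? (λ j → (j ≺? i) →-dec (L i j ≟ L′ i j)))

  InU? : Decidable InU
  InU? g = Fin.all? (λ i → Fin.all? (λ j → ¬? (i ≺? j) →-dec ((g ⊖ 𝟙) i j ≟ 0#)))

  InU-resp : ∀ {g h} → g ≈ h → InU g → InU h
  InU-resp g≈h g∈U i j i⊀j =
    trans (cong (_- 𝟙 i j) (sym (g≈h i j))) (g∈U i j i⊀j)

  anyU? : {Φ : Matrix size → Matrix size → Set} →
          (∀ {G G′ H H′} → G ≈ G′ → H ≈ H′ → Φ G H → Φ G′ H′) →
          B.Decidable Φ → Dec (Σ[ g ∈ U ] Φ (mat g) (inv g))
  anyU? {Φ} resp Φ? = map′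
    (λ (G , H , G∈U , r , l , p) →
      record { mat = G ; inv = H ; mat∈U = G∈U ; inverseʳ = r ; inverseˡ = l } , p)
    (λ (g , p) → mat g , inv g , mat∈U g , inverseʳ g , inverseˡ g , p)
    (anyMatrix? (λ e (H , x) → H , resp′ e (λ _ _ → refl) x) λ G →
     anyMatrix? (λ e → resp′ (λ _ _ → refl) e) λ H →
     InU? G ×-dec (G · H ≈? 𝟙) ×-dec (H · G ≈? 𝟙) ×-dec Φ? G H)
    where
    Ψ : Matrix size → Matrix size → Set
    Ψ G H = InU G × G · H ≈ 𝟙 × H · G ≈ 𝟙 × Φ G H

    resp′ : ∀ {G G′ H H′} → G ≈ G′ → H ≈ H′ → Ψ G H → Ψ G′ H′
    resp′ e f (G∈U , r , l , p) =
      InU-resp e G∈U , ≈-trans (≈-sym (·-cong e f)) r ,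
      ≈-trans (≈-sym (·-cong f e)) l , resp e f p

  conj-cong : ∀ {G G′ H H′ : Matrix size} (L : Matrix size) → G ≈ G′ → H ≈ H′ →
              G · L · H ≈ G′ · L · H′
  conj-cong L e f = ·-cong (·-cong {N = L} e (λ _ _ → refl)) f

  Conjugate : Rel (Matrix size) 0ℓ
  Conjugate X Y = Σ[ g ∈ U ] conj g X ≈ Y

  Conjugate? : B.Decidable Conjugate
  Conjugate? X Y = anyU?
    (λ e f p → ≈-trans (≈-sym (conj-cong X e f)) p)
    (λ G H → G · X · H ≈? Y)

k : FinPoset → ∀ {q} → FiniteField q → ℕ
k P F = Matrices.#classes F InU? Conjugate?
  where open PatternGroup P F

module SystemOrbits {P : FinPoset} (S : PosetSystem P) {q : ℕ} (F : FiniteField q) where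
  open FinPoset P
  open PosetSystem S
  open FiniteField F
  open Matrices F
  open PatternGroup P F
  private
    Q = star P m
    module Q = FinPoset Q
    module ℒQ = PatternGroup Q F

  -- Both quotients have matrices as representatives; π only coarsens the
  -- equality.
  π : Func ℒ ℒQ.ℒ
  π = record
    { to   = λ L → L
    ; cong = λ L≈L′ i j j≺i → L≈L′ i j (≺Q⇒≺ j≺i)
    }
    where
    ≺Q⇒≺ : ∀ {x y} → x Q.≺ y → x ≺ y
    ≺Q⇒≺ (inj₁ x≡y , x≢y)         = ⊥-elim (x≢y x≡y)
    ≺Q⇒≺ (inj₂ (refl , x≺m) , _) = x≺m

  𝟙A : Setoid.Carrier ℒQ.ℒ
  𝟙A i j = if does ((i Fin.≟ m) ×-dec (j ∈? A)) then 1# else 0#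

  -- The action of U_P on ℒ_Q through π: g · π(L) = π(K_g(L)). The matrix M
  -- is read as an element of ℒ_P lifting the class of M in ℒ_Q.
  Kπ : U → Setoid.Carrier ℒQ.ℒ → Setoid.Carrier ℒQ.ℒ
  Kπ g M = Func.to π (K g M)

  InStab : Pred U 0ℓ
  InStab g = Kπ g 𝟙A ℒQ.≈ℒ 𝟙A

  InFibre : Pred (Setoid.Carrier ℒ) 0ℓ
  InFibre L = Func.to π L ℒQ.≈ℒ 𝟙A

  SameOrbit : Rel (Setoid.Carrier ℒ) 0ℓ
  SameOrbit L L′ = Σ[ g ∈ U ] InStab g × K g L ≈ℒ L′

  InFibre? : Decidable InFibre
  InFibre? L = Func.to π L ℒQ.≈ℒ? 𝟙A

  SameOrbit? : B.Decidable SameOrbit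
  SameOrbit? L L′ = anyU?
    (λ e f (s , p) →
      (λ i j j≺i → trans (sym (conj-cong 𝟙A e f i j)) (s i j j≺i)) ,
      (λ i j j≺i → trans (sym (conj-cong L e f i j)) (p i j j≺i)))
    (λ G H → (G · 𝟙A · H ℒQ.≈ℒ? 𝟙A) ×-dec (G · L · H ≈ℒ? L′))

-- k(P,m,A)
kₛ : ∀ {P} → PosetSystem P → ∀ {q} → FiniteField q → ℕ
kₛ S F = Matrices.#classes F InFibre? SameOrbit?
  where open SystemOrbits S F

-- Since 𝔽_q is unique up to isomorphism, equality as functions of q is
-- equality for every finite field.
infix 4 _⇝_
record _⇝_ (P Q : FinPoset) : Set₁ where
  field
    n       : ℕ
    posets  : Fin (suc n) → FinPoset
    systems : (i : Fin n) → PosetSystem (posets (suc i))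
    first   : posets zero ≅ P
    last    : posets (fromℕ n) ≅ Q
    k≡kₛ    : ∀ i {q} (F : FiniteField q) → k (posets (inject₁ i)) F ≡ kₛ (systems i) F

module Diamond where

  b₁ b₂ b₃ b₄ c₁₂ c₁₃ c₁₄ c₂₃ c₂₄ c₃₄ t₁ t₂ t₃ : Fin 13
  b₁  = 0F
  b₂  = 1F
  b₃  = 2F
  b₄  = 3F
  c₁₂ = 4F
  c₁₃ = 5F
  c₁₄ = 6F
  c₂₃ = 7F
  c₂₄ = 8F
  c₃₄ = 9F
  t₁  = suc 9F
  t₂  = suc (suc 9F)
  t₃  = suc (suc (suc 9F))

  covers : List (Fin 13 × Fin 13)
  covers =
    (b₁ , c₁₂) ∷ (b₂ , c₁₂) ∷
    (b₁ , c₁₃) ∷ (b₃ , c₁₃) ∷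
    (b₁ , c₁₄) ∷ (b₄ , c₁₄) ∷
    (b₂ , c₂₃) ∷ (b₃ , c₂₃) ∷
    (b₂ , c₂₄) ∷ (b₄ , c₂₄) ∷
    (b₃ , c₃₄) ∷ (b₄ , c₃₄) ∷
    (c₁₃ , t₁) ∷ (c₁₄ , t₁) ∷ (c₂₃ , t₁) ∷ (c₂₄ , t₁) ∷
    (c₁₂ , t₂) ∷ (c₁₄ , t₂) ∷ (c₂₃ , t₂) ∷ (c₃₄ , t₂) ∷
    (c₁₂ , t₃) ∷ (c₁₃ , t₃) ∷ (c₂₄ , t₃) ∷ (c₃₄ , t₃) ∷ []

  private
    _≟₂_ : DecidableEquality (Fin 13 × Fin 13)
    _≟₂_ = ≡-dec Fin._≟_ Fin._≟_

  open ListMembership _≟₂_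
    using () renaming (_∈_ to _∈ₗ_; _∈?_ to _∈ₗ?_)

  infix 4 _⋖_ _⋖?_ _≤◇_ _≤◇?_
  _⋖_ : Rel (Fin 13) 0ℓ
  x ⋖ y = (x , y) ∈ₗ covers

  _≤◇_ : Rel (Fin 13) 0ℓ
  _≤◇_ = Star _⋖_

  _⋖?_ : B.Decidable _⋖_
  x ⋖? y = (x , y) ∈ₗ? covers

  private
    -- Saturated chains have at most two steps, which decides ≤◇.
    Short : Rel (Fin 13) 0ℓ
    Short x y = x ≡ y ⊎ x ⋖ y ⊎ ∃[ z ] (x ⋖ z × z ⋖ y)

    Short? : B.Decidable Short
    Short? x y = (x Fin.≟ y) ⊎-dec (x ⋖? y) ⊎-dec Fin.any? (λ z → (x ⋖? z) ×-dec (z ⋖? y))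

    no-3-step : ∀ w x → w ⋖ x → ∀ y → x ⋖ y → ∀ z → ¬ (y ⋖ z)
    no-3-step = from-yes
      (Fin.all? λ w → Fin.all? λ x → (w ⋖? x) →-dec
       Fin.all? λ y → (x ⋖? y) →-dec Fin.all? λ z → ¬? (y ⋖? z))

    ⋖⇒< : ∀ x y → x ⋖ y → x Fin.< y
    ⋖⇒< = from-yes (Fin.all? λ x → Fin.all? λ y → (x ⋖? y) →-dec (x Fin.<? y))

    short⇒star : ∀ {x y} → Short x y → x ≤◇ y
    short⇒star (inj₁ refl)                     = ε
    short⇒star (inj₂ (inj₁ x⋖y))               = x⋖y ◅ ε
    short⇒star (inj₂ (inj₂ (_ , x⋖z , z⋖y))) = x⋖z ◅ z⋖y ◅ ε

    star⇒short : ∀ {x y} → x ≤◇ y → Short x y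
    star⇒short ε                     = inj₁ refl
    star⇒short (p ◅ ε)               = inj₂ (inj₁ p)
    star⇒short (p ◅ r ◅ ε)           = inj₂ (inj₂ (_ , p , r))
    star⇒short (p ◅ r ◅ s ◅ _)       = ⊥-elim (no-3-step _ _ p _ r _ s)

    ≤◇⇒≤ : ∀ {x y} → x ≤◇ y → x Fin.≤ y
    ≤◇⇒≤ ε       = ℕ.≤-refl
    ≤◇⇒≤ (p ◅ r) = ℕ.≤-trans (ℕ.<⇒≤ (⋖⇒< _ _ p)) (≤◇⇒≤ r)

  _≤◇?_ : B.Decidable _≤◇_
  x ≤◇? y = map′ short⇒star star⇒short (Short? x y)

  P◇ : FinPoset
  P◇ = record
    { size              = 13
    ; _≼_               = _≤◇_
    ; isDecPartialOrder = record
      { isPartialOrder = record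
        { isPreorder = record
          { isEquivalence = isEquivalence
          ; reflexive     = λ { refl → ε }
          ; trans         = _◅◅_
          }
        ; antisym = λ p r → Fin.≤-antisym (≤◇⇒≤ p) (≤◇⇒≤ r)
        }
      ; _≟_  = Fin._≟_
      ; _≤?_ = _≤◇?_
      }
    }

open Diamond public using (P◇)

-- Proof idea. Let m be maximal in R and a ≺ m. On the fibre over 1_{a} the
-- row m of a matrix is fixed, its stabiliser in U_R consists of the g with
-- vanishing entries (a , y), y ≺ m, and the column m of g translates the
-- entries (i , a), a ≺ i ≺ m, arbitrarily. Hence k(R,m,{a}) is the number of
-- coadjoint orbits of the poset obtained from R by deleting the relations
-- x ≺ m and the relations a ≺ y with y ≺ m. The coadjoint orbits of a pattern
-- group are as many as its conjugacy classes: by Burnside's lemma it suffices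
-- that g fixes equally many points of 𝒰 and of its dual ℒ, and both numbers
-- follow from the number of zeros of the bilinear form
-- (X , L) ↦ tr (gXg⁻¹L) - tr (XL). A sequence of 46 such cuts turns the chain
-- into P◇ together with 46 isolated points, which do not affect k.

module Submission where

open import Defs
import Algebra.Properties.AbelianGroup as AbelianGroupProperties
import Algebra.Properties.CommutativeMonoid.Sum as Sum
import Algebra.Properties.CommutativeSemigroup as CommutativeSemigroupProperties
import Algebra.Properties.Group as GroupProperties
import Algebra.Properties.Ring as RingProperties
import Algebra.Properties.Semiring.Sum as SemiringSum
open import Algebra.Bundles using (CommutativeRing; Group)
open import Data.Bool.Base using (Bool; true; false; if_then_else_; T; not; _∧_; _∨_)
open import Data.Bool.Properties using (T-∧; T-∨)
import Data.Fin.Base as Fin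
import Data.Fin.Induction as Fin
import Data.Fin.Permutation as Perm
import Data.Fin.Properties as Fin
open import Data.Fin.Base using (Fin; zero; suc; toℕ; fromℕ; fromℕ<; inject₁)
open import Data.Fin.Subset using (⁅_⁆)
open import Data.Fin.Subset.Properties using (x∈⁅x⁆; x∈⁅y⁆⇒x≡y; _∈?_)
open import Data.List.Base using (List; []; _∷_; length; filter; deduplicate; lookup; tabulate)
import Data.List.Membership.Setoid as SetoidMembership
import Data.List.Membership.Setoid.Properties as SetoidMembershipₚ
open import Data.List.Membership.Propositional.Properties using (∈-lookup)
import Data.List.Relation.Unary.All as All
import Data.List.Relation.Unary.All.Properties as Allₚ
open import Data.List.Relation.Unary.All using (All)
open import Data.List.Relation.Unary.AllPairs using (AllPairs; _∷_)
import Data.List.Relation.Unary.Any as Any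
import Data.List.Relation.Unary.Any.Properties as Anyₚ
import Data.List.Relation.Unary.Unique.DecSetoid.Properties as UniqueDec
import Data.Nat.Base as ℕ
import Data.Nat.Properties as ℕ
import Data.Nat.Solver as ℕSolver
open import Data.Nat.Base using (ℕ; zero; suc; _∸_; _<ᵇ_; _≡ᵇ_)
open import Data.Product.Base using (Σ; Σ-syntax; ∃; ∃-syntax; _×_; _,_; proj₁; proj₂)
open import Data.Product.Function.NonDependent.Setoid using (_×-inverse_)
open import Data.Product.Relation.Binary.Pointwise.NonDependent using (_×ₛ_; Pointwise-≡↔≡)
open import Data.Sum.Base using (_⊎_; inj₁; inj₂)
open import Data.Unit.Base using (⊤; tt)
import Data.Vec.Base as Vec
open import Data.Vec.Base using (Vec; []; _∷_)
open import Function.Base using (_∘_; flip; id)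
open import Function.Bundles using (Equivalence; Inverse; _↔_; mk⇔; mk↔ₛ′)
import Function.Construct.Composition as Comp
import Function.Construct.Identity as Id
import Function.Construct.Symmetry as Symm
open import Function.Definitions using (Injective)
open import Induction.WellFounded using (Acc; acc; WellFounded)
open import Level using (0ℓ)
open import Relation.Binary.Bundles using (Setoid; DecSetoid)
import Relation.Binary.Construct.On as On
open import Relation.Binary.Core using (Rel)
import Relation.Binary.Definitions as B
import Relation.Binary.Morphism.Construct.Identity as Identity
open import Relation.Binary.PropositionalEquality as ≡
  using (_≡_; _≢_; refl; sym; trans; cong; cong₂; subst; subst₂; setoid; isEquivalence; module ≡-Reasoning)
open import Relation.Binary.Structures using (IsDecPartialOrder; IsEquivalence)
open import Relation.Nullary.Decidable
open import Relation.Nullary.Negation using (¬_; contradiction)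
open import Relation.Unary using (Pred; Decidable; _⊆_)

open SemiringSum ℕ.+-*-semiring
  using () renaming (sum to ∑ᴺ; sum-cong-≗ to ∑ᴺ-cong; *-distribˡ-sum to *-distribˡ-∑ᴺ)

-- A cut at `m` with `{a}` touches, besides the relations of `m`, only those from `a` into the lower
-- set of `m`. So it can be aimed: once an earlier cut has removed `t` from the lower set of `m`, a
-- relation `a ≺ t` survives the cut at `m`, while the relations from `a` into positions still below
-- `m` disappear. In this way a linear order can lose exactly the relations absent from the diamond,
-- and the order of the cuts matters. Each cut isolates its own `m`, whence 59 = 13 + 46.
--
-- The count of zeros works because, for fixed `X`, the form is additive in `L`: it vanishes
-- identically if `g` fixes `X`, and otherwise takes all `q` values equally often; the same holds
-- with the roles exchanged. Every count is a bijection with some `Fin n`, so numbers of orbits are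
-- compared by maps of representatives that respect orbits, and Burnside's lemma becomes a bijection
-- instead of a division by orders of stabilisers.

-- Cardinalities of setoids.

infix 4 _≃_
_≃_ : Setoid 0ℓ 0ℓ → Setoid 0ℓ 0ℓ → Set
_≃_ = Inverse

module _ (S T : Setoid 0ℓ 0ℓ) where
  private
    module S = Setoid S
    module T = Setoid T

  mk≃ : (to : S.Carrier → T.Carrier) (from : T.Carrier → S.Carrier) →
        (∀ {x y} → x S.≈ y → to x T.≈ to y) →
        (∀ {x y} → x T.≈ y → from x S.≈ from y) →
        (∀ y → to (from y) T.≈ y) → (∀ x → from (to x) S.≈ x) → S ≃ T
  mk≃ to from to-cong from-cong invˡ invʳ = record
    { to = to ; from = from ; to-cong = to-cong ; from-cong = from-cong
    ; inverse = (λ p → T.trans (to-cong p) (invˡ _)) , (λ p → S.trans (from-cong p) (invʳ _)) }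

-- Orbits are a coarser equality on the same carrier, so counting them forms no quotient, and two
-- counts agree as soon as a bijection of setoids links them.
Card : Setoid 0ℓ 0ℓ → ℕ → Set
Card S n = setoid (Fin n) ≃ S

card-resp : ∀ {S T n} → S ≃ T → Card S n → Card T n
card-resp S≃T c = Comp.inverse c S≃T

card-unique : ∀ {S m n} → Card S m → Card S n → m ≡ n
card-unique c d = Perm.↔⇒≡ (Comp.inverse c (Symm.inverse d))

card-× : ∀ {S T m n} → Card S m → Card T n → Card (S ×ₛ T) (m ℕ.* n)
card-× c d = Comp.inverse (Comp.inverse Fin.*↔× (Symm.inverse Pointwise-≡↔≡)) (c ×-inverse d)

Sub : (S : Setoid 0ℓ 0ℓ) → Pred (Setoid.Carrier S) 0ℓ → Setoid 0ℓ 0ℓ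
Sub S P = On.setoid S (proj₁ {B = P})

sub-≃ : ∀ {S : Setoid 0ℓ 0ℓ} {P Q : Pred (Setoid.Carrier S) 0ℓ} → P ⊆ Q → Q ⊆ P → Sub S P ≃ Sub S Q
sub-≃ {S} P⊆Q Q⊆P = mk≃ (Sub S _) (Sub S _) (λ (x , p) → x , P⊆Q p) (λ (x , q) → x , Q⊆P q)
  id id (λ _ → Setoid.refl S) (λ _ → Setoid.refl S)

fin-∑ : ∀ {n} (f : Fin n → ℕ) → Fin (∑ᴺ f) ↔ Σ (Fin n) (Fin ∘ f)
fin-∑ {zero}  f = mk↔ₛ′ (λ ()) (λ ()) (λ ()) (λ ())
fin-∑ {suc n} f = mk↔ₛ′ to from to-from from-to
  where
  open Inverse (fin-∑ (f ∘ suc)) using () renaming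
    (to to to′; from to from′; strictlyInverseˡ to to-from′; strictlyInverseʳ to from-to′)

  glue : Fin (f zero) ⊎ Fin (∑ᴺ (f ∘ suc)) → Σ (Fin (suc n)) (Fin ∘ f)
  glue (inj₁ j) = zero , j
  glue (inj₂ k) = suc (proj₁ (to′ k)) , proj₂ (to′ k)

  cut : Σ (Fin (suc n)) (Fin ∘ f) → Fin (f zero) ⊎ Fin (∑ᴺ (f ∘ suc))
  cut (zero  , j) = inj₁ j
  cut (suc i , j) = inj₂ (from′ (i , j))

  glue-cut : ∀ x → glue (cut x) ≡ x
  glue-cut (zero  , j) = refl
  glue-cut (suc i , j) = cong (λ (i , j) → suc i , j) (to-from′ (i , j))

  cut-glue : ∀ x → cut (glue x) ≡ x
  cut-glue (inj₁ j) = refl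
  cut-glue (inj₂ k) = cong inj₂ (from-to′ k)

  to : Fin (∑ᴺ f) → Σ (Fin (suc n)) (Fin ∘ f)
  to k = glue (Fin.splitAt (f zero) k)

  from : Σ (Fin (suc n)) (Fin ∘ f) → Fin (∑ᴺ f)
  from x = Fin.join (f zero) _ (cut x)

  to-from : ∀ x → to (from x) ≡ x
  to-from x = trans (cong glue (Fin.splitAt-join (f zero) _ (cut x))) (glue-cut x)

  from-to : ∀ k → from (to k) ≡ k
  from-to k = trans (cong (Fin.join (f zero) _) (cut-glue (Fin.splitAt (f zero) k)))
                    (Fin.join-splitAt (f zero) _ k)

module _ (V W : Setoid 0ℓ 0ℓ) (P : Setoid.Carrier V → Setoid.Carrier W → Set) where
  private
    module V = Setoid V
    module W = Setoid W

  -- Only the rows at enumerated representatives are counted; `resp` moves a pair with any other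
  -- first component into the row of its representative.
  card-Σ : ∀ {n f} → (∀ {v v′ w} → v V.≈ v′ → P v w → P v′ w) →
           (c : Card V n) → (∀ i → Card (Sub W (P (Inverse.to c i))) (f i)) →
           Card (Sub (V ×ₛ W) (λ (v , w) → P v w)) (∑ᴺ f)
  card-Σ {f = f} resp c d = Comp.inverse (fin-∑ f)
    (mk≃ _ (Sub (V ×ₛ W) _)
      (λ (i , j) → (C.to i , proj₁ (D.to i j)) , proj₂ (D.to i j))
      (λ ((v , w) , p) → C.from v , D.from (C.from v) (w , resp (V.sym (C.strictlyInverseˡ v)) p))
      (λ { refl → V.refl , W.refl })
      (λ (v≈ , w≈) → from-cong (C.from-cong v≈) w≈)
      (λ ((v , w) , p) → C.strictlyInverseˡ v , D.strictlyInverseˡ (C.from v) _)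
      (λ (i , j) → trans (from-cong {p′ = proj₂ (D.to i j)} (C.strictlyInverseʳ i) W.refl)
                         (cong (i ,_) (D.strictlyInverseʳ i j))))
    where
    module C = Inverse c
    module D i = Inverse (d i)

    from-cong : ∀ {i i′ w w′} {p : P (C.to i) w} {p′ : P (C.to i′) w′} → i ≡ i′ → w W.≈ w′ →
                _≡_ {A = Σ (Fin _) (Fin ∘ f)} (i , D.from i (w , p)) (i′ , D.from i′ (w′ , p′))
    from-cong {i} refl w≈ = cong (i ,_) (D.from-cong i w≈)

module _ {V W : Setoid 0ℓ 0ℓ} (P : Setoid.Carrier V → Setoid.Carrier W → Set) where
  private
    module V = Setoid V
    module W = Setoid W

  double-count : ∀ {m n f g} →
    (∀ {v v′ w} → v V.≈ v′ → P v w → P v′ w) → (∀ {v w w′} → w W.≈ w′ → P v w → P v w′) →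
    (c : Card V m) → (∀ i → Card (Sub W (P (Inverse.to c i))) (f i)) →
    (d : Card W n) → (∀ j → Card (Sub V (λ v → P v (Inverse.to d j))) (g j)) →
    ∑ᴺ f ≡ ∑ᴺ g
  double-count resp-v resp-w c cf d dg = card-unique (card-Σ V W P resp-v c cf)
    (card-resp
      (mk≃ (Sub (W ×ₛ V) _) (Sub (V ×ₛ W) _)
        (λ ((w , v) , p) → (v , w) , p) (λ ((v , w) , p) → (w , v) , p)
        (λ (x , y) → y , x) (λ (x , y) → y , x)
        (λ _ → V.refl , W.refl) (λ _ → W.refl , V.refl))
      (card-Σ W V (λ w v → P v w) resp-w d dg))

indicator : ∀ {A : Set} → Dec A → ℕ
indicator A? = if does A? then 1 else 0

-- A subset is a relation to the one-point set, whose rows have one element or none, so `card-Σ`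
-- counts it.
card-sub : ∀ {S n} {P : Pred (Setoid.Carrier S) 0ℓ} (P? : Decidable P) →
           (∀ {x y} → Setoid._≈_ S x y → P x → P y) → (c : Card S n) →
           Card (Sub S P) (∑ᴺ (λ i → indicator (P? (Inverse.to c i))))
card-sub {S} {n} {P} P? resp c = card-resp
  (mk≃ (Sub (S ×ₛ setoid ⊤) (λ (x , _) → P x)) (Sub S P) (λ ((x , _) , p) → x , p) (λ (x , p) → (x , _) , p)
    proj₁ (_, refl) (λ _ → Setoid.refl S) (λ _ → Setoid.refl S , refl))
  (card-Σ S (setoid ⊤) (λ x _ → P x) resp c (λ i → unit (P? (Inverse.to c i))))
  where
  unit : ∀ {A : Set} (A? : Dec A) → Card (Sub (setoid ⊤) (λ _ → A)) (indicator A?)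
  unit (yes a) = mk≃ _ (Sub (setoid ⊤) _) (λ _ → _ , a) (λ _ → zero) (λ _ → refl) (λ _ → refl)
    (λ _ → refl) (λ { zero → refl })
  unit (no ¬a) = mk≃ _ (Sub (setoid ⊤) _) (λ ()) (λ (_ , a) → contradiction a ¬a) (λ { {()} })
    (λ { {_ , a} _ → contradiction a ¬a }) (λ (_ , a) → contradiction a ¬a) (λ ())

module _ (D : DecSetoid 0ℓ 0ℓ) where
  open DecSetoid D using (Carrier; _≈_; _≟_) renaming (setoid to S)
  private module D = DecSetoid D
  open SetoidMembership S using (_∈_)

  lookup-injective : ∀ {xs} → AllPairs (λ x y → ¬ x ≈ y) xs →
                     ∀ i j → lookup xs i ≈ lookup xs j → i ≡ j
  lookup-injective (_ ∷ _)   zero    zero    _ = refl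
  lookup-injective (x≉ ∷ _)  zero    (suc j) e = contradiction e (All.lookup x≉ (∈-lookup j))
  lookup-injective (x≉ ∷ _)  (suc i) zero    e = contradiction (D.sym e) (All.lookup x≉ (∈-lookup i))
  lookup-injective (_ ∷ xs!) (suc i) (suc j) e = cong suc (lookup-injective xs! i j e)

  -- The retained list has one entry per class, so the position of the entry equivalent to `x`
  -- inverts the lookup.
  card-deduplicate : {P : Pred Carrier 0ℓ} (xs : List Carrier) → All P xs →
                     (∀ {x} → P x → x ∈ xs) → Card (Sub S P) (length (deduplicate _≟_ xs))
  card-deduplicate {P} xs all complete = mk≃ _ (Sub S P)
    (λ i → lookup ys i , All.lookup all-ys (∈-lookup i)) (λ (_ , p) → Any.index (y∈ p))
    (λ { refl → D.refl })
    (λ {(_ , p)} {(_ , p′)} x≈ → lookup-injective (UniqueDec.deduplicate-! D xs) _ _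
      (D.trans (D.sym (Anyₚ.lookup-index (y∈ p))) (D.trans x≈ (Anyₚ.lookup-index (y∈ p′)))))
    (λ (_ , p) → D.sym (Anyₚ.lookup-index (y∈ p)))
    (λ i → lookup-injective (UniqueDec.deduplicate-! D xs) _ _
      (D.sym (Anyₚ.lookup-index (y∈ (All.lookup all-ys (∈-lookup i))))))
    where
    ys = deduplicate _≟_ xs

    all-ys : All P ys
    all-ys = Allₚ.deduplicate⁺ _≟_ all

    y∈ : ∀ {x} → P x → x ∈ ys
    y∈ p = SetoidMembershipₚ.∈-deduplicate⁺ S _≟_ (λ z≈y x≈y → D.trans x≈y (D.sym z≈y)) (complete p)

  card-surjection : ∀ {n} (f : Fin n → Carrier) → (∀ x → ∃[ i ] x ≈ f i) → ∃ (Card S)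
  card-surjection f surj = _ , card-resp
    (mk≃ (Sub S (λ _ → ⊤)) S proj₁ (_, _) id id (λ _ → D.refl) (λ _ → D.refl))
    (card-deduplicate (tabulate f) (All.universal _ _)
      (λ {x} _ → Anyₚ.tabulate⁺ (proj₁ (surj x)) (proj₂ (surj x))))

-- Group actions and Burnside's lemma.

record Action (G : Group 0ℓ 0ℓ) (X : Setoid 0ℓ 0ℓ) : Set where
  private
    module G = Group G
    module X = Setoid X
  infixr 5 _▷_
  field
    _▷_    : G.Carrier → X.Carrier → X.Carrier
    ▷-cong : ∀ {g h x y} → g G.≈ h → x X.≈ y → g ▷ x X.≈ h ▷ y
    ▷-ε    : ∀ x → G.ε ▷ x X.≈ x
    ▷-∙    : ∀ g h x → (g G.∙ h) ▷ x X.≈ g ▷ h ▷ x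

  Fixes : G.Carrier → X.Carrier → Set
  Fixes g x = g ▷ x X.≈ x

  ▷-⁻¹ : ∀ g x → g G.⁻¹ ▷ g ▷ x X.≈ x
  ▷-⁻¹ g x = X.trans (X.sym (▷-∙ _ _ x)) (X.trans (▷-cong (G.inverseˡ g) X.refl) (▷-ε x))

  fixes-resp : ∀ {g h x y} → g G.≈ h → x X.≈ y → Fixes g x → Fixes h y
  fixes-resp g≈h x≈y p = X.trans (▷-cong (G.sym g≈h) (X.sym x≈y)) (X.trans p x≈y)

  fixes-⁻¹ : ∀ g x → Fixes g x → Fixes (g G.⁻¹) x
  fixes-⁻¹ g x p = X.trans (▷-cong G.refl (X.sym p)) (▷-⁻¹ g x)

  Orbits : Setoid 0ℓ 0ℓ
  Orbits = record
    { Carrier       = X.Carrier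
    ; _≈_           = λ x y → ∃[ g ] g ▷ x X.≈ y
    ; isEquivalence = record
      { refl  = G.ε , ▷-ε _
      ; sym   = λ (g , p) → g G.⁻¹ , X.trans (▷-cong G.refl (X.sym p)) (▷-⁻¹ g _)
      ; trans = λ (g , p) (h , r) →
          h G.∙ g , X.trans (▷-∙ h g _) (X.trans (▷-cong G.refl p) r)
      }
    }

  module _ {m n l} (cG : Card G.setoid m) (cX : Card X n) (cO : Card Orbits l) where
    private
      module cX = Inverse cX
      module cO = Inverse cO
      module O = Setoid Orbits

      class : X.Carrier → Fin l
      class x = cO.from (cX.to (cX.from x))

      class-cong : ∀ {x y} → x X.≈ y → class x ≡ class y
      class-cong x≈y = ≡.cong (λ i → cO.from (cX.to i)) (cX.from-cong x≈y)

      class-▷ : ∀ h j → class (h ▷ cO.to j) ≡ j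
      class-▷ h j = ≡.trans
        (cO.from-cong (O.sym {cO.to j} (h , X.sym (cX.strictlyInverseˡ _))))
        (cO.strictlyInverseʳ j)

      -- Routing the choice through the enumerated element equal to x makes it
      -- compatible with the equality of X.
      t : X.Carrier → G.Carrier
      t x = proj₁ (cO.strictlyInverseˡ (cX.to (cX.from x)))

      t-cong : ∀ {x y} → x X.≈ y → t x ≡ t y
      t-cong x≈y = ≡.cong (λ i → proj₁ (cO.strictlyInverseˡ (cX.to i))) (cX.from-cong x≈y)

      t-▷ : ∀ x → t x ▷ cO.to (class x) X.≈ x
      t-▷ x = X.trans (proj₂ (cO.strictlyInverseˡ (cX.to (cX.from x)))) (cX.strictlyInverseˡ x)

      t⁻¹-▷ : ∀ x → t x G.⁻¹ ▷ x X.≈ cO.to (class x)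
      t⁻¹-▷ x = X.trans (▷-cong G.refl (X.sym (t-▷ x))) (▷-⁻¹ (t x) _)

      FixedPairs : Setoid 0ℓ 0ℓ
      FixedPairs = Sub (G.setoid ×ₛ X) (λ (g , x) → Fixes g x)

      to : G.Carrier × Fin l → Setoid.Carrier FixedPairs
      to (h , j) = (h G.∙ t (h ▷ cO.to j) G.⁻¹ , h ▷ cO.to j) ,
        X.trans (▷-∙ _ _ _) (▷-cong G.refl (X.trans (t⁻¹-▷ _) (X.reflexive (≡.cong cO.to (class-▷ h j)))))

      from : Setoid.Carrier FixedPairs → G.Carrier × Fin l
      from ((g , x) , _) = g G.∙ t x , class x

      t-reflexive : ∀ {x y} → x X.≈ y → t x G.≈ t y
      t-reflexive x≈y = G.reflexive (t-cong x≈y)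

    -- Every pair (g , x) with g ▷ x ≈ x is determined by the element g ∙ t x,
    -- where t x carries the representative of the orbit of x to x, together
    -- with that orbit, and all such data occur.
    burnside : Card FixedPairs (m ℕ.* l)
    burnside = card-resp
      (mk≃ (G.setoid ×ₛ ≡.setoid (Fin l)) FixedPairs to from
        (λ { (g≈h , ≡.refl) → let e = ▷-cong g≈h X.refl in G.∙-cong g≈h (G.⁻¹-cong (t-reflexive e)) , e })
        (λ (g≈h , x≈y) → G.∙-cong g≈h (t-reflexive x≈y) , class-cong x≈y)
        (λ ((g , x) , p) →
          let e : (g G.∙ t x) ▷ cO.to (class x) X.≈ x
              e = X.trans (▷-∙ _ _ _) (X.trans (▷-cong G.refl (t-▷ x)) p)
          in G.trans (G.∙-cong G.refl (G.⁻¹-cong (t-reflexive e))) (//-rightDividesʳ (t x) g) , e)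
        (λ (h , j) → //-rightDividesˡ (t (h ▷ cO.to j)) h , class-▷ h j))
      (card-× cG (Id.inverse _))
      where open GroupProperties G using (//-rightDividesˡ; //-rightDividesʳ)

-- Zeros of bilinear forms over a finite field.

∑-const-+ : ∀ {n} c d (f : Fin n → ℕ) →
            ∑ᴺ (λ i → c ℕ.+ f i ℕ.* d) ≡ n ℕ.* c ℕ.+ ∑ᴺ f ℕ.* d
∑-const-+ {zero}  c d f = refl
∑-const-+ {suc n} c d f = begin
  (c ℕ.+ f zero ℕ.* d) ℕ.+ ∑ᴺ (λ i → c ℕ.+ f (suc i) ℕ.* d)
    ≡⟨ cong ((c ℕ.+ f zero ℕ.* d) ℕ.+_) (∑-const-+ c d (f ∘ suc)) ⟩
  (c ℕ.+ f zero ℕ.* d) ℕ.+ (n ℕ.* c ℕ.+ ∑ᴺ (f ∘ suc) ℕ.* d)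
    ≡⟨ solve 5 (λ c a d n s → (c :+ a :* d) :+ (n :* c :+ s :* d) :=
                              (con 1 :+ n) :* c :+ (a :+ s) :* d) refl c (f zero) d n _ ⟩
  suc n ℕ.* c ℕ.+ ∑ᴺ f ℕ.* d ∎
  where
  open ≡-Reasoning
  open ℕSolver.+-*-Solver

module FieldCounting {q : ℕ} (F : FiniteField q) where
  open FiniteField F
  open CommutativeRing commutativeRing public
    using (+-assoc; +-comm; +-identityˡ; +-identityʳ; *-assoc; *-comm; *-identityˡ; *-identityʳ;
           zeroˡ; zeroʳ; distribˡ; distribʳ; -‿inverseˡ; -‿inverseʳ; ring; semiring)

  q≡1+ : q ≡ suc (q ∸ 1)
  q≡1+ = nonempty (Inverse.from enumeration 0#)
    where
    nonempty : ∀ {n} → Fin n → n ≡ suc (n ∸ 1)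
    nonempty {suc n} _ = refl

  q∸1-nonZero : ℕ.NonZero (q ∸ 1)
  q∸1-nonZero = two (Inverse.from enumeration 0#) (Inverse.from enumeration 1#)
    (λ e → 0≢1 (trans (sym (Inverse.strictlyInverseˡ enumeration 0#))
                 (trans (cong (Inverse.to enumeration) e) (Inverse.strictlyInverseˡ enumeration 1#))))
    where
    two : ∀ {n} (i j : Fin n) → i ≢ j → ℕ.NonZero (n ∸ 1)
    two {suc zero}    zero zero i≢j = contradiction refl i≢j
    two {suc (suc n)} _    _    _   = _

  -- An action of the additive group of the field on `W` along which `β` grows by the acting
  -- element: the form in which a nonzero linear functional enters the count.
  record Shift (W : Setoid 0ℓ 0ℓ) (β : Setoid.Carrier W → Carrier) : Set where
    private module W = Setoid W
    field
      shift      : Carrier → W.Carrier → W.Carrier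
      shift-cong : ∀ c {x y} → x W.≈ y → shift c x W.≈ shift c y
      shift-+    : ∀ c d x → shift c (shift d x) W.≈ shift (d + c) x
      shift-0    : ∀ x → shift 0# x W.≈ x
      β-shift    : ∀ c x → β (shift c x) ≡ β x + c

    -- Moving `w` by `- β w` lands among the zeros, so `W` is the product of the field with the set
    -- of zeros.
    card-zeros : ∀ {z m} → (∀ {x y} → x W.≈ y → β x ≡ β y) →
                 Card (Sub W (λ w → β w ≡ 0#)) z → Card W m → q ℕ.* z ≡ m
    card-zeros β-cong cZ cW = card-unique (card-resp
      (mk≃ (setoid Carrier ×ₛ Sub W (λ w → β w ≡ 0#)) W
        (λ (c , (w , _)) → shift c w)
        (λ w → β w , shift (- β w) w , trans (β-shift _ w) (-‿inverseʳ (β w)))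
        (λ { (refl , w≈) → shift-cong _ w≈ })
        (λ {x} {y} x≈y → β-cong x≈y , subst (λ b → shift (- β x) x W.≈ shift (- b) y) (β-cong x≈y) (shift-cong _ x≈y))
        (λ w → W.trans (shift-+ _ _ w) (subst (λ c → shift c w W.≈ w) (sym (-‿inverseˡ (β w))) (shift-0 w)))
        (λ (c , (w , p)) → let e = β-of c w p in e ,
          subst (λ b → shift (- b) (shift c w) W.≈ w) (sym e)
            (W.trans (shift-+ _ _ w) (subst (λ c → shift c w W.≈ w) (sym (-‿inverseʳ c)) (shift-0 w)))))
      (card-× enumeration cZ)) cW
      where
      β-of : ∀ c w → β w ≡ 0# → β (shift c w) ≡ c
      β-of c w p = trans (β-shift c w) (trans (cong (_+ c) p) (+-identityˡ c))

  -- What is kept of bilinearity: each `B v` either vanishes identically or can be raised by any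
  -- amount through a translation of `W`. `Ker` is a field so that it can be instantiated with fixed
  -- points of a group element.
  record Form (V W : Setoid 0ℓ 0ℓ) : Set₁ where
    private
      module V = Setoid V
      module W = Setoid W
    field
      B        : V.Carrier → W.Carrier → Carrier
      B-cong   : ∀ {v v′ w w′} → v V.≈ v′ → w W.≈ w′ → B v w ≡ B v′ w′
      Ker      : Pred V.Carrier 0ℓ
      Ker?     : Decidable Ker
      ker⇒0    : ∀ {v} → Ker v → ∀ w → B v w ≡ 0#
      ¬ker⇒    : ∀ {v} → ¬ Ker v → Shift W (B v)

    zeros : ∀ {m} (cW : Card W m) v → Card (Sub W (λ w → B v w ≡ 0#))
                                            (∑ᴺ (λ j → indicator (B v (Inverse.to cW j) ≟ 0#)))
    zeros cW v = card-sub (λ w → B v w ≟ 0#) (λ e p → trans (B-cong V.refl (W.sym e)) p) cW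

    -- Outside the kernel the zeros are a `q`-th part of `W`, inside it they are all of `W`; the
    -- factor `q` clears the denominator, and `q * m` is `m + (q ∸ 1) * m`.
    q*zeros : ∀ {m} (cW : Card W m) v → q ℕ.* ∑ᴺ (λ j → indicator (B v (Inverse.to cW j) ≟ 0#)) ≡
                                m ℕ.+ indicator (Ker? v) ℕ.* ((q ∸ 1) ℕ.* m)
    q*zeros {m} cW v with Ker? v
    ... | no ¬ker = trans (Shift.card-zeros (¬ker⇒ ¬ker) (B-cong V.refl) (zeros cW v) cW) (sym (ℕ.+-identityʳ m))
    ... | yes ker = trans (cong (q ℕ.*_) (card-unique (zeros cW v) (card-resp everything cW)))
                     (trans (cong (ℕ._* m) q≡1+) (cong (m ℕ.+_) (sym (ℕ.+-identityʳ _))))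
      where
      everything : W ≃ Sub W (λ w → B v w ≡ 0#)
      everything = mk≃ W (Sub W _) (λ w → w , ker⇒0 ker w) proj₁ (λ e → e) (λ e → e) (λ _ → W.refl) (λ _ → W.refl)

    count-zeros : ∀ {m n} (cV : Card V m) (cW : Card W n) →
      q ℕ.* ∑ᴺ (λ i → ∑ᴺ (λ j → indicator (B (Inverse.to cV i) (Inverse.to cW j) ≟ 0#))) ≡
      m ℕ.* n ℕ.+ ∑ᴺ (λ i → indicator (Ker? (Inverse.to cV i))) ℕ.* ((q ∸ 1) ℕ.* n)
    count-zeros {n = n} cV cW =
      trans (*-distribˡ-∑ᴺ q (λ i → ∑ᴺ (λ j → indicator (B (Inverse.to cV i) (Inverse.to cW j) ≟ 0#))))
      (trans (∑ᴺ-cong (λ i → q*zeros cW (Inverse.to cV i)))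
             (∑-const-+ n ((q ∸ 1) ℕ.* n) (λ i → indicator (Ker? (Inverse.to cV i)))))

  -- Both kernels are determined by the number of zeros of the form, counted
  -- row by row and column by column.
  card-kernels : ∀ {V W m} (φ : Form V W) (ψ : Form W V) → (∀ v w → Form.B φ v w ≡ Form.B ψ w v) →
                 (cV : Card V (suc m)) (cW : Card W (suc m)) →
                 ∑ᴺ (λ i → indicator (Form.Ker? φ (Inverse.to cV i))) ≡
                 ∑ᴺ (λ j → indicator (Form.Ker? ψ (Inverse.to cW j)))
  card-kernels {V} {W} {m} φ ψ B≡ cV cW =
    -- Since `V` and `W` are equinumerous, the constant term and the factor of the kernel count are
    -- the same on both sides. The factor can be cancelled because the field has at least two
    -- elements and the sets are nonempty.
    ℕ.*-cancelʳ-≡ _ _ ((q ∸ 1) ℕ.* suc m) {{ℕ.m*n≢0 (q ∸ 1) (suc m) {{q∸1-nonZero}}}}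
      (ℕ.+-cancelˡ-≡ (suc m ℕ.* suc m) _ _
        (trans (sym (count-zeros φ cV cW)) (trans (cong (q ℕ.*_) zeros≡) (count-zeros ψ cW cV))))
    where
    open Form
    zeros≡ : ∑ᴺ (λ i → ∑ᴺ (λ j → indicator (B φ (Inverse.to cV i) (Inverse.to cW j) ≟ 0#))) ≡
             ∑ᴺ (λ j → ∑ᴺ (λ i → indicator (B ψ (Inverse.to cW j) (Inverse.to cV i) ≟ 0#)))
    zeros≡ = double-count {V} {W} (λ v w → B φ v w ≡ 0#)
      (λ e p → trans (B-cong φ (Setoid.sym V e) (Setoid.refl W)) p)
      (λ e p → trans (B-cong φ (Setoid.refl V) (Setoid.sym W e)) p)
      cV (λ i → zeros φ cW (Inverse.to cV i))
      cW (λ j → card-resp (sub-≃ (λ p → trans (B≡ _ _) p) (λ p → trans (sym (B≡ _ _)) p))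
                          (zeros ψ cV (Inverse.to cW j)))

-- Matrix algebra and the trace form.

module MatrixAlgebra {q : ℕ} (F : FiniteField q) where
  open FiniteField F
  open FieldCounting F
  open Matrices F
  open Sum +-commutativeMonoid using (sum-syntax; sum-cong-≗; ∑-comm; ∑-distrib-+)
  open AbelianGroupProperties (CommutativeRing.+-abelianGroup commutativeRing)
    using () renaming (x∙y⁻¹≈ε⇒x≈y to x-y≡0⇒x≡y; x≈y⇒x∙y⁻¹≈ε to x≡y⇒x-y≡0) public

  *-distribˡ-∑ : ∀ {n} x (f : Fin n → Carrier) → x * (∑[ i < n ] f i) ≡ ∑[ i < n ] (x * f i)
  *-distribˡ-∑ {n} x f = SemiringSum.*-distribˡ-sum semiring x f

  *-distribʳ-∑ : ∀ {n} x (f : Fin n → Carrier) → (∑[ i < n ] f i) * x ≡ ∑[ i < n ] (f i * x)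
  *-distribʳ-∑ {n} x f = SemiringSum.*-distribʳ-sum semiring x f

  ∑-zero : ∀ {n} (f : Fin n → Carrier) → (∀ i → f i ≡ 0#) → ∑[ i < n ] f i ≡ 0#
  ∑-zero {zero}  f f≡0 = refl
  ∑-zero {suc n} f f≡0 = trans (cong₂ _+_ (f≡0 zero) (∑-zero (f ∘ suc) (f≡0 ∘ suc))) (+-identityˡ 0#)

  ∑-single : ∀ {n} (f : Fin n → Carrier) i → (∀ k → k ≢ i → f k ≡ 0#) → ∑[ k < n ] f k ≡ f i
  ∑-single f zero    f≡0 = trans (cong (f zero +_) (∑-zero (f ∘ suc) (λ k → f≡0 (suc k) λ ()))) (+-identityʳ _)
  ∑-single f (suc i) f≡0 = trans (cong₂ _+_ (f≡0 zero λ ())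
    (∑-single (f ∘ suc) i (λ k k≢i → f≡0 (suc k) (k≢i ∘ Fin.suc-injective)))) (+-identityˡ _)

  𝟙-diagonal : ∀ {n} (i : Fin n) → 𝟙 i i ≡ 1#
  𝟙-diagonal i = cong (if_then 1# else 0#) (dec-true (i Fin.≟ i) refl)

  𝟙-off-diagonal : ∀ {n} (i j : Fin n) → i ≢ j → 𝟙 i j ≡ 0#
  𝟙-off-diagonal i j i≢j = cong (if_then 1# else 0#) (dec-false (i Fin.≟ j) i≢j)

  ≈-refl : ∀ {n} {M : Matrix n} → M ≈ M
  ≈-refl i j = refl

  ·-identityˡ : ∀ {n} (M : Matrix n) → 𝟙 · M ≈ M
  ·-identityˡ M i j = trans
    (∑-single _ i (λ k k≢i → trans (cong (_* M k j) (𝟙-off-diagonal i k (k≢i ∘ sym))) (zeroˡ _)))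
    (trans (cong (_* M i j) (𝟙-diagonal i)) (*-identityˡ _))

  ·-identityʳ : ∀ {n} (M : Matrix n) → M · 𝟙 ≈ M
  ·-identityʳ M i j = trans
    (∑-single _ j (λ k k≢j → trans (cong (M i k *_) (𝟙-off-diagonal k j k≢j)) (zeroʳ _)))
    (trans (cong (M i j *_) (𝟙-diagonal j)) (*-identityʳ _))

  ·-assoc : ∀ {n} (L M N : Matrix n) → (L · M) · N ≈ L · (M · N)
  ·-assoc {n} L M N i j = begin
    ∑[ l < n ] ((∑[ k < n ] (L i k * M k l)) * N l j) ≡⟨ sum-cong-≗ (λ l → *-distribʳ-∑ (N l j) (λ k → L i k * M k l)) ⟩
    ∑[ l < n ] ∑[ k < n ] (L i k * M k l * N l j)     ≡⟨ ∑-comm (λ l k → L i k * M k l * N l j) ⟩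
    ∑[ k < n ] ∑[ l < n ] (L i k * M k l * N l j)     ≡⟨ sum-cong-≗ (λ k → trans
                                                           (sum-cong-≗ (λ l → *-assoc (L i k) (M k l) (N l j)))
                                                           (sym (*-distribˡ-∑ (L i k) (λ l → M k l * N l j)))) ⟩
    ∑[ k < n ] (L i k * (∑[ l < n ] (M k l * N l j))) ∎
    where open ≡-Reasoning

  infixl 6 _⊕_
  _⊕_ : ∀ {n} → Matrix n → Matrix n → Matrix n
  (M ⊕ N) i j = M i j + N i j

  infixr 8 _•_
  _•_ : ∀ {n} → Carrier → Matrix n → Matrix n
  (c • M) i j = c * M i j

  ·-distribˡ-⊕ : ∀ {n} (L M N : Matrix n) → L · (M ⊕ N) ≈ L · M ⊕ L · N
  ·-distribˡ-⊕ L M N i j =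
    trans (sum-cong-≗ (λ k → distribˡ (L i k) (M k j) (N k j))) (∑-distrib-+ (λ k → L i k * M k j) _)

  ·-distribʳ-⊕ : ∀ {n} (L M N : Matrix n) → (M ⊕ N) · L ≈ M · L ⊕ N · L
  ·-distribʳ-⊕ L M N i j =
    trans (sum-cong-≗ (λ k → distribʳ (L k j) (M i k) (N i k))) (∑-distrib-+ (λ k → M i k * L k j) _)

  ⊖-⊕ : ∀ {n} (M N : Matrix n) → M ≈ (M ⊖ N) ⊕ N
  ⊖-⊕ M N i j = sym (trans (+-assoc _ _ _) (trans (cong (M i j +_) (-‿inverseˡ _)) (+-identityʳ _)))

  ⊕⇒⊖ : ∀ {n} {L M N : Matrix n} → L ≈ M ⊕ N → L ⊖ N ≈ M
  ⊕⇒⊖ {N = N} e i j = trans (cong (_- N i j) (e i j)) (trans (+-assoc _ _ _)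
    (trans (cong (_ +_) (-‿inverseʳ _)) (+-identityʳ _)))

  ·-distribʳ-⊖ : ∀ {n} (L M N : Matrix n) → (M ⊖ N) · L ≈ M · L ⊖ N · L
  ·-distribʳ-⊖ L M N = ≈-sym (⊕⇒⊖ (≈-trans (·-cong (⊖-⊕ M N) (≈-refl {M = L})) (·-distribʳ-⊕ L (M ⊖ N) N)))

  ·-distribˡ-⊖ : ∀ {n} (L M N : Matrix n) → L · (M ⊖ N) ≈ L · M ⊖ L · N
  ·-distribˡ-⊖ L M N = ≈-sym (⊕⇒⊖ (≈-trans (·-cong (≈-refl {M = L}) (⊖-⊕ M N)) (·-distribˡ-⊕ L (M ⊖ N) N)))

  ⊖-cong : ∀ {n} {M M′ N N′ : Matrix n} → M ≈ M′ → N ≈ N′ → M ⊖ N ≈ M′ ⊖ N′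
  ⊖-cong e f i j = cong₂ _-_ (e i j) (f i j)

  tr : ∀ {n} → Matrix n → Carrier
  tr {n} M = ∑[ i < n ] M i i

  tr-cong : ∀ {n} {M N : Matrix n} → M ≈ N → tr M ≡ tr N
  tr-cong e = sum-cong-≗ (λ i → e i i)

  tr-⊕ : ∀ {n} (M N : Matrix n) → tr (M ⊕ N) ≡ tr M + tr N
  tr-⊕ M N = ∑-distrib-+ (λ i → M i i) _

  tr-comm : ∀ {n} (M N : Matrix n) → tr (M · N) ≡ tr (N · M)
  tr-comm M N = trans (∑-comm (λ i k → M i k * N k i))
    (sum-cong-≗ (λ k → sum-cong-≗ (λ i → *-comm (M i k) (N k i))))

  E : ∀ {n} → Carrier → Fin n → Fin n → Matrix n
  E c i j k l = if does (k Fin.≟ i ×-dec l Fin.≟ j) then c else 0#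

  E-entry : ∀ {n} c (i j : Fin n) → E c i j i j ≡ c
  E-entry c i j = cong (if_then c else 0#) (dec-true (i Fin.≟ i ×-dec j Fin.≟ j) (refl , refl))

  E-zero : ∀ {n} c (i j k l : Fin n) → ¬ (k ≡ i × l ≡ j) → E c i j k l ≡ 0#
  E-zero c i j k l ¬e = cong (if_then c else 0#) (dec-false (k Fin.≟ i ×-dec l Fin.≟ j) ¬e)

  -- Source of nondegeneracy: pairing with a matrix unit reads off the entry at the transposed
  -- position.
  tr-·E : ∀ {n} (M : Matrix n) c i j → tr (M · E c j i) ≡ M i j * c
  tr-·E {n} M c i j = begin
    ∑[ k < n ] ∑[ l < n ] (M k l * E c j i l k)
      ≡⟨ ∑-single _ i (λ k k≢i → ∑-zero _ (λ l → trans (cong (M k l *_) (E-zero c j i l k (k≢i ∘ proj₂))) (zeroʳ _))) ⟩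
    ∑[ l < n ] (M i l * E c j i l i)
      ≡⟨ ∑-single _ j (λ l l≢j → trans (cong (M i l *_) (E-zero c j i l i (l≢j ∘ proj₁))) (zeroʳ _)) ⟩
    M i j * E c j i j i ≡⟨ cong (M i j *_) (E-entry c j i) ⟩
    M i j * c ∎
    where open ≡-Reasoning

  matrixSetoid : ℕ → DecSetoid 0ℓ 0ℓ
  matrixSetoid n = record
    { Carrier = Matrix n ; _≈_ = _≈_
    ; isDecEquivalence = record
      { isEquivalence = record { refl = ≈-refl ; sym = ≈-sym ; trans = ≈-trans } ; _≟_ = _≈?_ } }

-- Unitriangular matrices over a poset and their two actions.

module FinPosetProperties (P : FinPoset) where
  open FinPoset P

  ≼-≺-trans : ∀ {x y z} → x ≼ y → y ≺ z → x ≺ z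
  ≼-≺-trans x≼y (y≼z , y≢z) = ≼-trans x≼y y≼z , λ { refl → y≢z (antisym y≼z x≼y) }

  ≺-≼-trans : ∀ {x y z} → x ≺ y → y ≼ z → x ≺ z
  ≺-≼-trans (x≼y , x≢y) y≼z = ≼-trans x≼y y≼z , λ { refl → x≢y (antisym x≼y y≼z) }

  ≺-trans : ∀ {x y z} → x ≺ y → y ≺ z → x ≺ z
  ≺-trans x≺y (y≼z , _) = ≺-≼-trans x≺y y≼z

  ≺-irrefl : ∀ {x} → ¬ x ≺ x
  ≺-irrefl (_ , x≢x) = x≢x refl

  ≻-wellFounded : WellFounded (flip _≺_)
  ≻-wellFounded = Fin.po-noetherian (IsDecPartialOrder.isPartialOrder isDecPartialOrder)

module Unitriangular (P : FinPoset) {q : ℕ} (F : FiniteField q) where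
  open FinPoset P
  open FinPosetProperties P
  open FiniteField F
  open Matrices F
  open PatternGroup P F
  open FieldCounting F
  open MatrixAlgebra F
  open Sum +-commutativeMonoid using (sum-syntax; sum-cong-≗)

  Upper : Pred (Matrix size) 0ℓ
  Upper M = ∀ i j → ¬ i ≼ j → M i j ≡ 0#

  Uni : Pred (Matrix size) 0ℓ
  Uni M = ∀ i j → ¬ i ≺ j → M i j ≡ 𝟙 i j

  InU⇒Uni : ∀ {M} → InU M → Uni M
  InU⇒Uni M∈U i j i⊀j = x-y≡0⇒x≡y _ _ (M∈U i j i⊀j)

  Uni⇒InU : ∀ {M} → Uni M → InU M
  Uni⇒InU uni i j i⊀j = x≡y⇒x-y≡0 (uni i j i⊀j)

  Uni⇒Upper : ∀ {M} → Uni M → Upper M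
  Uni⇒Upper uni i j i⋠j = trans (uni i j (i⋠j ∘ proj₁)) (𝟙-off-diagonal i j λ { refl → i⋠j ≼-refl })

  𝟙-uni : Uni 𝟙
  𝟙-uni i j _ = refl

  In𝒰-·-Upper : ∀ {M N} → In𝒰 M → Upper N → In𝒰 (M · N)
  In𝒰-·-Upper {M} {N} M∈𝒰 N-up i j i⊀j = ∑-zero _ term
    where
    term : ∀ k → M i k * N k j ≡ 0#
    term k with i ≺? k
    ... | yes i≺k = trans (cong (M i k *_) (N-up k j (i⊀j ∘ ≺-≼-trans i≺k))) (zeroʳ _)
    ... | no  i⊀k = trans (cong (_* N k j) (M∈𝒰 i k i⊀k)) (zeroˡ _)

  Upper-·-In𝒰 : ∀ {M N} → Upper M → In𝒰 N → In𝒰 (M · N)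
  Upper-·-In𝒰 {M} {N} M-up N∈𝒰 i j i⊀j = ∑-zero _ term
    where
    term : ∀ k → M i k * N k j ≡ 0#
    term k with i ≼? k
    ... | yes i≼k = trans (cong (M i k *_) (N∈𝒰 k j (i⊀j ∘ ≼-≺-trans i≼k))) (zeroʳ _)
    ... | no  i⋠k = trans (cong (_* N k j) (M-up i k i⋠k)) (zeroˡ _)

  -- `M · N ⊖ N` equals `(M ⊖ 𝟙) · N`, which lies in 𝒰 because 𝒰 absorbs upper triangular factors;
  -- so off the strict order the product agrees with `N`.
  uni-· : ∀ {M N} → Uni M → Uni N → Uni (M · N)
  uni-· {M} {N} M-uni N-uni i j i⊀j = trans
    (x-y≡0⇒x≡y _ _ (trans (sym (trans (·-distribʳ-⊖ N M 𝟙 i j) (cong (λ x → (M · N) i j - x) (·-identityˡ N i j))))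
                          (In𝒰-·-Upper (Uni⇒InU M-uni) (Uni⇒Upper N-uni) i j i⊀j)))
    (N-uni i j i⊀j)

  -- Row i of M · N ≈ 𝟙 expresses row i of N by the rows k ≻ i.
  uni-inverse : ∀ {M N} → Uni M → M · N ≈ 𝟙 → Uni N
  uni-inverse {M} {N} M-uni MN≈𝟙 i = go i (≻-wellFounded i)
    where
    go : ∀ i → Acc (flip _≺_) i → ∀ j → ¬ i ≺ j → N i j ≡ 𝟙 i j
    go i (acc rec) j i⊀j = trans (sym (trans (cong (_* N i j) (trans (M-uni i i ≺-irrefl) (𝟙-diagonal i))) (*-identityˡ _)))
      (trans (sym (∑-single _ i term)) (MN≈𝟙 i j))
      where
      term : ∀ k → k ≢ i → M i k * N k j ≡ 0#
      term k k≢i with i ≺? k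
      ... | yes i≺k = trans (cong (M i k *_) (trans (go k (rec i≺k) j (i⊀j ∘ ≺-trans i≺k))
                        (𝟙-off-diagonal k j λ { refl → i⊀j i≺k }))) (zeroʳ _)
      ... | no  i⊀k = trans (cong (_* N k j) (trans (M-uni i k i⊀k) (𝟙-off-diagonal i k (k≢i ∘ sym)))) (zeroˡ _)

  uni : ∀ g → Uni (mat g)
  uni g = InU⇒Uni (mat∈U g)

  inv-uni : ∀ g → Uni (inv g)
  inv-uni g = uni-inverse (uni g) (inverseʳ g)

  εᵁ : U
  εᵁ = record { mat = 𝟙 ; inv = 𝟙 ; mat∈U = Uni⇒InU 𝟙-uni ; inverseʳ = ·-identityˡ 𝟙 ; inverseˡ = ·-identityˡ 𝟙 }

  cancel-middle : ∀ {L M M′ N : Matrix size} → M · M′ ≈ 𝟙 → L · N ≈ 𝟙 → (L · M) · (M′ · N) ≈ 𝟙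
  cancel-middle {L} {M} {M′} {N} e f = ≈-trans (·-assoc L M (M′ · N)) (≈-trans
    (·-cong (≈-refl {M = L}) (≈-trans (≈-sym (·-assoc M M′ N)) (≈-trans (·-cong e (≈-refl {M = N})) (·-identityˡ N)))) f)

  infixr 7 _∙ᵁ_
  _∙ᵁ_ : U → U → U
  g ∙ᵁ h = record
    { mat      = mat g · mat h
    ; inv      = inv h · inv g
    ; mat∈U    = Uni⇒InU (uni-· (uni g) (uni h))
    ; inverseʳ = cancel-middle (inverseʳ h) (inverseʳ g)
    ; inverseˡ = cancel-middle (inverseˡ g) (inverseˡ h)
    }

  infix 8 _⁻¹ᵁ
  _⁻¹ᵁ : U → U
  g ⁻¹ᵁ = record
    { mat = inv g ; inv = mat g ; mat∈U = Uni⇒InU (inv-uni g) ; inverseʳ = inverseˡ g ; inverseˡ = inverseʳ g }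

  inv-cong : ∀ g h → mat g ≈ mat h → inv g ≈ inv h
  inv-cong g h e = ≈-trans (≈-sym (·-identityʳ (inv g))) (≈-trans
    (·-cong (≈-refl {M = inv g}) (≈-sym (inverseʳ h))) (≈-trans (≈-sym (·-assoc (inv g) (mat h) (inv h)))
    (≈-trans (·-cong (≈-trans (·-cong (≈-refl {M = inv g}) (≈-sym e)) (inverseˡ g)) (≈-refl {M = inv h})) (·-identityˡ (inv h)))))

  group : Group 0ℓ 0ℓ
  group = record
    { Carrier = U
    ; _≈_     = λ g h → mat g ≈ mat h
    ; _∙_     = _∙ᵁ_
    ; ε       = εᵁ
    ; _⁻¹     = _⁻¹ᵁ
    ; isGroup = record
      { isMonoid = record
        { isSemigroup = record
          { isMagma = record
            { isEquivalence = record { refl = ≈-refl ; sym = ≈-sym ; trans = ≈-trans }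
            ; ∙-cong = ·-cong
            }
          ; assoc = λ g h k → ·-assoc (mat g) (mat h) (mat k)
          }
        ; identity = (λ g → ·-identityˡ (mat g)) , (λ g → ·-identityʳ (mat g))
        }
      ; inverse = inverseˡ , inverseʳ
      ; ⁻¹-cong = λ {g} {h} → inv-cong g h
      }
    }

  conj-ε : ∀ L → conj εᵁ L ≈ L
  conj-ε L = ≈-trans (·-identityʳ (𝟙 · L)) (·-identityˡ L)

  conj-∙ : ∀ g h L → conj (g ∙ᵁ h) L ≈ conj g (conj h L)
  conj-∙ g h L = ≈-trans (≈-sym (·-assoc (mat g · mat h · L) (inv h) (inv g)))
    (·-cong (≈-trans (·-cong (·-assoc (mat g) (mat h) L) (≈-refl {M = inv h})) (·-assoc (mat g) (mat h · L) (inv h)))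
            (≈-refl {M = inv g}))

  conj-congʳ : ∀ g {L L′} → L ≈ L′ → conj g L ≈ conj g L′
  conj-congʳ g e = ·-cong (·-cong (≈-refl {M = mat g}) e) (≈-refl {M = inv g})

  conj-congˡ : ∀ g h L → mat g ≈ mat h → conj g L ≈ conj h L
  conj-congˡ g h L e = conj-cong L e (inv-cong g h e)

  conj-⊖ : ∀ g L L′ → conj g (L ⊖ L′) ≈ conj g L ⊖ conj g L′
  conj-⊖ g L L′ = ≈-trans (·-cong (·-distribˡ-⊖ (mat g) L L′) (≈-refl {M = inv g}))
                          (·-distribʳ-⊖ (inv g) (mat g · L) (mat g · L′))

  conj-𝟙 : ∀ g → conj g 𝟙 ≈ 𝟙
  conj-𝟙 g = ≈-trans (·-cong (·-identityʳ (mat g)) (≈-refl {M = inv g})) (inverseʳ g)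

  conj-In𝒰 : ∀ g {X} → In𝒰 X → In𝒰 (conj g X)
  conj-In𝒰 g X∈𝒰 = In𝒰-·-Upper (Upper-·-In𝒰 (Uni⇒Upper (uni g)) X∈𝒰) (Uni⇒Upper (inv-uni g))

  -- For `j ≺ i` only those `k` with `i ≼ k` contribute, and then `j ≺ k`: entries ignored by ℒ
  -- never flow into entries it keeps. With its mirror image this makes the coadjoint action well
  -- defined.
  Upper-·-≈ℒ : ∀ {M L L′} → Upper M → L ≈ℒ L′ → M · L ≈ℒ M · L′
  Upper-·-≈ℒ {M} {L} {L′} M-up e i j j≺i = sum-cong-≗ term
    where
    term : ∀ k → M i k * L k j ≡ M i k * L′ k j
    term k with i ≼? k
    ... | yes i≼k = cong (M i k *_) (e k j (≺-≼-trans j≺i i≼k))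
    ... | no  i⋠k rewrite M-up i k i⋠k = trans (zeroˡ _) (sym (zeroˡ _))

  ≈ℒ-·-Upper : ∀ {M L L′} → Upper M → L ≈ℒ L′ → L · M ≈ℒ L′ · M
  ≈ℒ-·-Upper {M} {L} {L′} M-up e i j j≺i = sum-cong-≗ term
    where
    term : ∀ k → L i k * M k j ≡ L′ i k * M k j
    term k with k ≼? j
    ... | yes k≼j = cong (_* M k j) (e i k (≼-≺-trans k≼j j≺i))
    ... | no  k⋠j rewrite M-up k j k⋠j = trans (zeroʳ _) (sym (zeroʳ _))

  conj-≈ℒ : ∀ g {L L′} → L ≈ℒ L′ → conj g L ≈ℒ conj g L′
  conj-≈ℒ g e = ≈ℒ-·-Upper (Uni⇒Upper (inv-uni g)) (Upper-·-≈ℒ (Uni⇒Upper (uni g)) e)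

  ≈⇒≈ℒ : ∀ {L L′} → L ≈ L′ → L ≈ℒ L′
  ≈⇒≈ℒ e i j _ = e i j

  𝒰 : Setoid 0ℓ 0ℓ
  𝒰 = Sub (DecSetoid.setoid (matrixSetoid size)) In𝒰

  𝒰-action : Action group 𝒰
  𝒰-action = record
    { _▷_    = λ g (X , X∈𝒰) → conj g X , conj-In𝒰 g X∈𝒰
    ; ▷-cong = λ {g} {h} {x} {y} e f → ≈-trans (conj-congˡ g h (proj₁ x) e) (conj-congʳ h f)
    ; ▷-ε    = λ (X , _) → conj-ε X
    ; ▷-∙    = λ g h (X , _) → conj-∙ g h X
    }

  ℒ-action : Action group ℒ
  ℒ-action = record
    { _▷_    = K
    ; ▷-cong = λ {g} {h} {L} e f → Setoid.trans ℒ (≈⇒≈ℒ (conj-congˡ g h L e)) (conj-≈ℒ h f)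
    ; ▷-ε    = λ L → ≈⇒≈ℒ (conj-ε L)
    ; ▷-∙    = λ g h L → ≈⇒≈ℒ (conj-∙ g h L)
    }

-- Conjugacy classes and coadjoint orbits.

module Classes {q : ℕ} (F : FiniteField q) where
  open Matrices F
  open MatrixAlgebra F

  -- The list `matrices` meets each matrix only up to pointwise equality, hence the two
  -- compatibility hypotheses.
  card-#classes : ∀ {n} {In : Pred (Matrix n) 0ℓ} {_∼_ : Rel (Matrix n) 0ℓ}
                  (In? : Decidable In) (∼? : B.Decidable _∼_) (eq : IsEquivalence _∼_) →
                  (∀ {M N} → M ≈ N → M ∼ N) → (∀ {M N} → M ≈ N → In M → In N) →
                  Card (Sub (record { isEquivalence = eq }) In) (#classes In? ∼?)
  card-#classes {n} {In} In? ∼? eq ≈⇒∼ resp = card-deduplicate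
    (record { isDecEquivalence = record { isEquivalence = eq ; _≟_ = ∼? } })
    (filter In? (matrices n)) (Allₚ.all-filter In? (matrices n))
    (λ {M} M∈In → Any.map ≈⇒∼
      (SetoidMembershipₚ.∈-filter⁺ (DecSetoid.setoid (matrixSetoid n)) In? resp
        (Anyₚ.tabulate⁺ (encode M) (decode-encode M)) M∈In))

module CoadjointOrbits (P : FinPoset) {q : ℕ} (F : FiniteField q) where
  open FinPoset P
  open FinPosetProperties P
  open FiniteField F
  open FieldCounting F
  open Matrices F
  open MatrixAlgebra F
  open Classes F
  open PatternGroup P F
  open Unitriangular P F
  open Sum +-commutativeMonoid using (sum-syntax; sum-cong-≗)
  open RingProperties ring using (-‿+-comm)
  open CommutativeSemigroupProperties (CommutativeRing.+-commutativeSemigroup commutativeRing) using (interchange)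

  CoOrbits : Setoid 0ℓ 0ℓ
  CoOrbits = Action.Orbits ℒ-action

  conjugate-isEquivalence : IsEquivalence Conjugate
  conjugate-isEquivalence = record
    { refl  = εᵁ , conj-ε _
    ; sym   = λ {X} (g , p) → g ⁻¹ᵁ , ≈-trans (conj-congʳ (g ⁻¹ᵁ) (≈-sym p))
                (≈-trans (≈-sym (conj-∙ (g ⁻¹ᵁ) g X)) (≈-trans (conj-congˡ (g ⁻¹ᵁ ∙ᵁ g) εᵁ X (inverseˡ g)) (conj-ε X)))
    ; trans = λ {X} (g , p) (h , r) → h ∙ᵁ g , ≈-trans (conj-∙ h g X) (≈-trans (conj-congʳ h p) r)
    }

  -- Conjugation fixes `𝟙`, so subtracting it turns conjugation on the group into the linear action
  -- on 𝒰.
  card-classes : Card (Action.Orbits 𝒰-action) (k P F)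
  card-classes = card-resp
    (mk≃ (Sub _ InU) (Action.Orbits 𝒰-action)
      (λ (X , X∈U) → X ⊖ 𝟙 , X∈U)
      (λ (X , X∈𝒰) → X ⊕ 𝟙 , λ i j i⊀j → trans (⊕⇒⊖ {M = X} {N = 𝟙} ≈-refl i j) (X∈𝒰 i j i⊀j))
      (λ {(X , _)} (g , p) → g , ≈-trans (conj-⊖ g X 𝟙) (⊖-cong p (conj-𝟙 g)))
      (λ {(X , _)} (g , p) → g , ≈-trans (conj-⊕𝟙 g X) (λ i j → cong (_+ 𝟙 i j) (p i j)))
      (λ (X , _) → εᵁ , ≈-trans (conj-ε _) (⊕⇒⊖ {M = X} {N = 𝟙} ≈-refl))
      (λ (X , _) → εᵁ , ≈-trans (conj-ε _) (≈-sym (⊖-⊕ X 𝟙))))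
    (card-#classes InU? Conjugate? conjugate-isEquivalence (λ e → εᵁ , ≈-trans (conj-ε _) e) InU-resp)
    where
    conj-⊕𝟙 : ∀ g X → conj g (X ⊕ 𝟙) ≈ conj g X ⊕ 𝟙
    conj-⊕𝟙 g X = ≈-trans (·-cong (·-distribˡ-⊕ (mat g) X 𝟙) (≈-refl {M = inv g}))
      (≈-trans (·-distribʳ-⊕ (inv g) (mat g · X) (mat g · 𝟙))
               (λ i j → cong (conj g X i j +_) (conj-𝟙 g i j)))

  -- A nonzero entry `X i k` has `i ≺ k` and meets `L k i`, an entry kept by ℒ; so the trace pairs 𝒰
  -- with the quotient ℒ.
  tr-·-congʳ : ∀ (X L L′ : Matrix size) → In𝒰 X → L ≈ℒ L′ → tr (X · L) ≡ tr (X · L′)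
  tr-·-congʳ X L L′ X∈𝒰 e = sum-cong-≗ (λ i → sum-cong-≗ (term i))
    where
    term : ∀ i k → X i k * L k i ≡ X i k * L′ k i
    term i k with i ≺? k
    ... | yes i≺k = cong (X i k *_) (e k i i≺k)
    ... | no  i⊀k rewrite X∈𝒰 i k i⊀k = trans (zeroˡ _) (sym (zeroˡ _))

  tr-·-congˡ : ∀ (X X′ L : Matrix size) → X ≈ X′ → tr (X · L) ≡ tr (X′ · L)
  tr-·-congˡ X X′ L e = tr-cong (·-cong e (≈-refl {M = L}))

  -- By cyclicity of the trace, the adjoint of conjugation by `g` is conjugation by its inverse;
  -- this is why the form on ℒ is later taken at `g ⁻¹ᵁ`.
  tr-conj : ∀ g X L → tr (conj g X · L) ≡ tr (X · conj (g ⁻¹ᵁ) L)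
  tr-conj g X L = trans
    (tr-cong (≈-trans (·-assoc (mat g · X) (inv g) L) (·-assoc (mat g) X (inv g · L))))
    (trans (tr-comm (mat g) (X · (inv g · L))) (tr-cong (·-assoc X (inv g · L) (mat g))))

  tr-·-⊕• : ∀ (M L : Matrix size) c (N : Matrix size) → tr (M · (L ⊕ c • N)) ≡ tr (M · L) + c * tr (M · N)
  tr-·-⊕• M L c N = trans (tr-cong (·-distribˡ-⊕ M L (c • N))) (trans (tr-⊕ (M · L) (M · (c • N)))
    (cong (tr (M · L) +_) (trans (sum-cong-≗ (λ i → trans (sum-cong-≗ (λ k → pull (M i k) (N k i)))
      (sym (*-distribˡ-∑ c (λ k → M i k * N k i))))) (sym (*-distribˡ-∑ c (λ i → (M · N) i i))))))
    where
    pull : ∀ x y → x * (c * y) ≡ c * (x * y)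
    pull x y = trans (sym (*-assoc x c y)) (trans (cong (_* y) (*-comm x c)) (*-assoc c x y))

  +-*-difference : ∀ a u x v c → u - v ≡ 1# → (a + c * u) - (x + c * v) ≡ (a - x) + c
  +-*-difference a u x v c u-v≡1 = begin
    (a + c * u) + - (x + c * v)     ≡⟨ cong ((a + c * u) +_) (-‿+-comm x (c * v)) ⟨
    (a + c * u) + (- x + - (c * v)) ≡⟨ interchange a (c * u) (- x) (- (c * v)) ⟩
    (a - x) + (c * u - c * v)       ≡⟨ cong ((a - x) +_) (x[y-z]≈xy-xz c u v) ⟨
    (a - x) + c * (u - v)           ≡⟨ cong (λ t → (a - x) + c * t) u-v≡1 ⟩
    (a - x) + c * 1#                ≡⟨ cong ((a - x) +_) (*-identityʳ c) ⟩
    (a - x) + c                     ∎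
    where
    open ≡-Reasoning
    open RingProperties ring using (x[y-z]≈xy-xz)

  -- The scalar is the inverse of the difference of the two entries. This normalises the direction,
  -- so that moving `c` times along it raises the form by exactly `c`.
  dual-unit : ∀ {A A′ : Matrix size} {i j} → A i j ≢ A′ i j →
              ∃[ c ] tr (A · E c j i) - tr (A′ · E c j i) ≡ 1#
  dual-unit {A} {A′} {i} {j} A≢A′ =
    let (c , δc≡1) = invertible (A i j - A′ i j) (A≢A′ ∘ x-y≡0⇒x≡y _ _) in
    c , trans (cong₂ _-_ (tr-·E A c i j) (tr-·E A′ c i j)) (trans (sym ([y-z]x≈yx-zx c (A i j) (A′ i j))) δc≡1)
    where open RingProperties ring using ([y-z]x≈yx-zx)

  ⊕•-+ : ∀ (M N : Matrix size) c d → (M ⊕ d • N) ⊕ c • N ≈ M ⊕ (d + c) • N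
  ⊕•-+ M N c d i j = trans (+-assoc _ _ _) (cong (M i j +_) (sym (distribʳ (N i j) d c)))

  ⊕•-0 : ∀ (M N : Matrix size) → M ⊕ 0# • N ≈ M
  ⊕•-0 M N i j = trans (cong (M i j +_) (zeroˡ (N i j))) (+-identityʳ _)

  ≉⇒entry : ∀ {M N : Matrix size} → ¬ M ≈ N → ∃[ i ] ∃[ j ] M i j ≢ N i j
  ≉⇒entry {M} {N} M≉N =
    let (i , p) = Fin.¬∀⟶∃¬ _ _ (λ i → Fin.all? (λ j → M i j ≟ N i j)) M≉N
        (j , r) = Fin.¬∀⟶∃¬ _ _ (λ j → M i j ≟ N i j) p
    in i , j , r

  ≉ℒ⇒entry : ∀ {M N : Matrix size} → ¬ M ≈ℒ N → ∃[ i ] ∃[ j ] j ≺ i × M i j ≢ N i j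
  ≉ℒ⇒entry {M} {N} M≉N =
    let (i , p) = Fin.¬∀⟶∃¬ _ _ (λ i → Fin.all? (λ j → (j ≺? i) →-dec (M i j ≟ N i j))) M≉N
        (j , r) = Fin.¬∀⟶∃¬ _ _ (λ j → (j ≺? i) →-dec (M i j ≟ N i j)) p
    in i , j , decidable-stable (j ≺? i) (λ j⊀i → r (λ j≺i → contradiction j≺i j⊀i)) , (λ e → r (λ _ → e))

  E-In𝒰 : ∀ c {i j} → i ≺ j → In𝒰 (E c i j)
  E-In𝒰 c {i} {j} i≺j k l k⊀l = E-zero c i j k l (λ { (refl , refl) → k⊀l i≺j })

  -- The kernel is the fixed-point set of `g`: an entry where `conj g X` and `X` differ yields a
  -- matrix unit on which the form does not vanish.
  form-𝒰 : U → Form 𝒰 ℒ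
  form-𝒰 g = record
    { B      = λ (X , _) L → tr (conj g X · L) - tr (X · L)
    ; B-cong = λ {(X , X∈𝒰)} {(X′ , X′∈𝒰)} {L} {L′} e f → cong₂ _-_
        (trans (tr-·-congˡ (conj g X) (conj g X′) L (conj-congʳ g e)) (tr-·-congʳ (conj g X′) L L′ (conj-In𝒰 g X′∈𝒰) f))
        (trans (tr-·-congˡ X X′ L e) (tr-·-congʳ X′ L L′ X′∈𝒰 f))
    ; Ker    = λ (X , _) → conj g X ≈ X
    ; Ker?   = λ (X , _) → conj g X ≈? X
    ; ker⇒0  = λ {(X , _)} gX≈X L → x≡y⇒x-y≡0 (tr-·-congˡ (conj g X) X L gX≈X)
    ; ¬ker⇒  = λ {(X , _)} gX≉X →
        let (i , j , gX≢X)  = ≉⇒entry gX≉X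
            (c₀ , unit) = dual-unit {A = conj g X} {A′ = X} gX≢X
            N = E c₀ j i
        in record
          { shift      = λ c L → L ⊕ c • N
          ; shift-cong = λ c e i j j≺i → cong (_+ c * N i j) (e i j j≺i)
          ; shift-+    = λ c d L → ≈⇒≈ℒ (⊕•-+ L N c d)
          ; shift-0    = λ L → ≈⇒≈ℒ (⊕•-0 L N)
          ; β-shift    = λ c L → trans (cong₂ _-_ (tr-·-⊕• (conj g X) L c N) (tr-·-⊕• X L c N))
                                   (+-*-difference _ _ _ _ c unit)
          }
    }

  form-ℒ : U → Form ℒ 𝒰
  form-ℒ g = record
    { B      = λ L (X , _) → tr (X · conj g L) - tr (X · L)
    ; B-cong = λ {L} {L′} {(X , X∈𝒰)} {(X′ , X′∈𝒰)} e f → cong₂ _-_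
        (trans (tr-·-congˡ X X′ (conj g L) f) (tr-·-congʳ X′ (conj g L) (conj g L′) X′∈𝒰 (conj-≈ℒ g e)))
        (trans (tr-·-congˡ X X′ L f) (tr-·-congʳ X′ L L′ X′∈𝒰 e))
    ; Ker    = λ L → conj g L ≈ℒ L
    ; Ker?   = λ L → conj g L ≈ℒ? L
    ; ker⇒0  = λ {L} gL≈L (X , X∈𝒰) → x≡y⇒x-y≡0 (tr-·-congʳ X (conj g L) L X∈𝒰 gL≈L)
    ; ¬ker⇒  = λ {L} gL≉L →
        let (i , j , j≺i , gL≢L)  = ≉ℒ⇒entry gL≉L
            (c₀ , unit) = dual-unit {A = conj g L} {A′ = L} gL≢L
            -- The differing entry comes with `j ≺ i`, so `N` lies in 𝒰 and the shift does not leave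
            -- 𝒰.
            N = E c₀ j i
            swap : ∀ X c M → tr ((X ⊕ c • N) · M) ≡ tr (X · M) + c * tr (M · N)
            swap X c M = trans (tr-comm (X ⊕ c • N) M) (trans (tr-·-⊕• M X c N) (cong (_+ c * tr (M · N)) (tr-comm M X)))
        in record
          { shift      = λ c (X , X∈𝒰) → X ⊕ c • N , λ i j i⊀j →
              trans (cong₂ _+_ (X∈𝒰 i j i⊀j) (trans (cong (c *_) (E-In𝒰 c₀ j≺i i j i⊀j)) (zeroʳ c))) (+-identityˡ 0#)
          ; shift-cong = λ c e i j → cong (_+ c * N i j) (e i j)
          ; shift-+    = λ c d (X , _) → ⊕•-+ X N c d
          ; shift-0    = λ (X , _) → ⊕•-0 X N
          ; β-shift    = λ c (X , _) → trans (cong₂ _-_ (swap X c (conj g L)) (swap X c L))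
                                   (+-*-difference _ _ _ _ c unit)
          }
    }

  -- Transposition, where `mask` picks the representative vanishing off the order. It supplies the
  -- equal cardinalities demanded by `card-kernels`.
  𝒰≃ℒ : 𝒰 ≃ ℒ
  𝒰≃ℒ = mk≃ 𝒰 ℒ (flip ∘ proj₁) (λ L → mask L , mask-In𝒰 L)
    (λ e i j _ → e j i) mask-cong (λ L i j j≺i → mask-≺ L j≺i) (λ (X , X∈𝒰) i j → mask-flip X X∈𝒰 i j)
    where
    mask : Matrix size → Matrix size
    mask L i j with i ≺? j
    ... | yes _ = L j i
    ... | no  _ = 0#

    mask-≺ : ∀ L {i j} → i ≺ j → mask L i j ≡ L j i
    mask-≺ L {i} {j} i≺j with i ≺? j
    ... | yes _ = refl
    ... | no ¬p = contradiction i≺j ¬p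

    mask-In𝒰 : ∀ L → In𝒰 (mask L)
    mask-In𝒰 L i j i⊀j with i ≺? j
    ... | yes p = contradiction p i⊀j
    ... | no _  = refl

    mask-cong : ∀ {L L′} → L ≈ℒ L′ → mask L ≈ mask L′
    mask-cong e i j with i ≺? j
    ... | yes p = e j i p
    ... | no _  = refl

    mask-flip : ∀ X → In𝒰 X → mask (flip X) ≈ X
    mask-flip X X∈𝒰 i j with i ≺? j
    ... | yes _ = refl
    ... | no p  = sym (X∈𝒰 i j p)

  card-ℒ : ∃[ n ] Card ℒ (suc n)
  card-ℒ = positive (card-surjection
    (record { isDecEquivalence = record { isEquivalence = Setoid.isEquivalence ℒ ; _≟_ = _≈ℒ?_ } })
    decode (λ L → encode L , ≈⇒≈ℒ (decode-encode L)))
    where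
    positive : ∃ (Card ℒ) → ∃[ n ] Card ℒ (suc n)
    positive (suc n , c) = n , c
    positive (zero  , c) with () ← Inverse.from c 𝟙

  card-U : ∃[ n ] Card (Group.setoid group) (suc n)
  card-U = positive (_ , card-resp
    (mk≃ (Sub (DecSetoid.setoid (matrixSetoid size)) Invertible) (Group.setoid group)
      (λ (_ , g , g≈M) → g) (λ g → mat g , g , ≈-refl)
      (λ {(_ , _ , p)} {(_ , _ , r)} e → ≈-trans p (≈-trans e (≈-sym r))) id
      (λ _ → ≈-refl) (λ (_ , _ , p) → p))
    (card-sub Invertible? (λ e (g , p) → g , ≈-trans p e) (proj₂ (card-surjection (matrixSetoid size)
      decode (λ L → encode L , decode-encode L)))))
    where
    Invertible : Pred (Matrix size) 0ℓ
    Invertible M = Σ[ g ∈ U ] mat g ≈ M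

    Invertible? : Decidable Invertible
    Invertible? M = anyU? (λ e _ p → ≈-trans (≈-sym e) p) (λ G _ → G ≈? M)

    positive : ∃ (Card (Group.setoid group)) → ∃[ n ] Card (Group.setoid group) (suc n)
    positive (suc n , c) = n , c
    positive (zero  , c) with () ← Inverse.from c εᵁ

  fixed-points : ∀ {n} (c𝒰 : Card 𝒰 (suc n)) (cℒ : Card ℒ (suc n)) g →
    ∑ᴺ (λ i → indicator (Form.Ker? (form-𝒰 g) (Inverse.to c𝒰 i))) ≡
    ∑ᴺ (λ j → indicator (conj (g ⁻¹ᵁ) (Inverse.to cℒ j) ≈ℒ? Inverse.to cℒ j))
  fixed-points c𝒰 cℒ g = card-kernels (form-𝒰 g) (form-ℒ (g ⁻¹ᵁ))
    (λ (X , _) L → cong (_- tr (X · L)) (tr-conj g X L)) c𝒰 cℒ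

  -- Burnside turns both numbers of orbits into sums of fixed points over the group; the sums agree
  -- term by term, and the positive group order cancels.
  k≡#CoOrbits : ∀ {m n l} → Card (Group.setoid group) (suc m) → Card 𝒰 (suc n) → Card ℒ (suc n) →
                Card CoOrbits l → k P F ≡ l
  k≡#CoOrbits {m} {l = l} cU c𝒰 cℒ cO = ℕ.*-cancelˡ-≡ (k P F) l (suc m) (trans
    (card-unique burnside-𝒰 fixed-𝒰)
    (trans (∑ᴺ-cong (λ i → fixed-points c𝒰 cℒ (Inverse.to cU i)))
      (sym (card-unique burnside-ℒ fixed-ℒ))))
    where
    burnside-𝒰 : Card (Sub (Group.setoid group ×ₛ 𝒰) (λ (g , X) → Action.Fixes 𝒰-action g X)) (suc m ℕ.* k P F)
    burnside-𝒰 = Action.burnside 𝒰-action cU c𝒰 card-classes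

    burnside-ℒ : Card (Sub (Group.setoid group ×ₛ ℒ) (λ (g , L) → Action.Fixes ℒ-action g L)) (suc m ℕ.* l)
    burnside-ℒ = Action.burnside ℒ-action cU cℒ cO

    fixed-𝒰 : Card (Sub (Group.setoid group ×ₛ 𝒰) (λ (g , X) → Action.Fixes 𝒰-action g X))
                (∑ᴺ (λ i → ∑ᴺ (λ j → indicator (Form.Ker? (form-𝒰 (Inverse.to cU i)) (Inverse.to c𝒰 j)))))
    fixed-𝒰 = card-Σ (Group.setoid group) 𝒰 (Action.Fixes 𝒰-action)
      (λ {g} {h} {X} e → Action.fixes-resp 𝒰-action {g} {h} {X} {X} e (≈-refl {M = proj₁ X})) cU
      (λ i → card-sub (Form.Ker? (form-𝒰 (Inverse.to cU i)))
        (λ {X} {Y} → Action.fixes-resp 𝒰-action {Inverse.to cU i} {Inverse.to cU i} {X} {Y} (≈-refl {M = mat (Inverse.to cU i)})) c𝒰)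

    fixed-ℒ : Card (Sub (Group.setoid group ×ₛ ℒ) (λ (g , L) → Action.Fixes ℒ-action g L))
                (∑ᴺ (λ i → ∑ᴺ (λ j → indicator (conj (Inverse.to cU i ⁻¹ᵁ) (Inverse.to cℒ j) ≈ℒ? Inverse.to cℒ j))))
    fixed-ℒ = card-Σ (Group.setoid group) ℒ (Action.Fixes ℒ-action)
      (λ {g} {h} {L} e → Action.fixes-resp ℒ-action {g} {h} {L} {L} e (Setoid.refl ℒ {L})) cU
      -- The adjoint form counts the fixed points of the inverse. These are the fixed points of `g`,
      -- the matrices of the double inverse being those of `g` by computation.
      (λ i → card-resp
        (sub-≃ (λ {L} → Action.fixes-⁻¹ ℒ-action (Inverse.to cU i ⁻¹ᵁ) L) (λ {L} → Action.fixes-⁻¹ ℒ-action (Inverse.to cU i) L))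
        (card-sub (λ L → conj (Inverse.to cU i ⁻¹ᵁ) L ≈ℒ? L)
          (λ {L} {L′} → Action.fixes-resp ℒ-action {Inverse.to cU i ⁻¹ᵁ} {Inverse.to cU i ⁻¹ᵁ} {L} {L′}
            (≈-refl {M = inv (Inverse.to cU i)})) cℒ))

  -- Brauer's permutation lemma for U_P acting on 𝒰_P and on its dual ℒ_P.
  card-CoOrbits : Card CoOrbits (k P F)
  card-CoOrbits = go card-U card-ℒ (card-surjection coOrbitsᵈ decode surjective)
    where
    coOrbitsᵈ : DecSetoid 0ℓ 0ℓ
    coOrbitsᵈ = record { isDecEquivalence = record
      { isEquivalence = Setoid.isEquivalence CoOrbits
      ; _≟_ = λ L L′ → anyU? (λ e f p → Setoid.trans ℒ (≈⇒≈ℒ (≈-sym (conj-cong L e f))) p)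
                              (λ G H → G · L · H ≈ℒ? L′) } }

    surjective : ∀ L → ∃[ i ] Σ[ g ∈ U ] conj g L ≈ℒ decode i
    surjective L = encode L , εᵁ , ≈⇒≈ℒ (≈-trans (conj-ε L) (decode-encode L))

    go : ∃[ m ] Card (Group.setoid group) (suc m) → ∃[ n ] Card ℒ (suc n) → ∃ (Card CoOrbits) →
         Card CoOrbits (k P F)
    go (_ , cU) (_ , cℒ) (_ , cO) =
      subst (Card CoOrbits) (sym (k≡#CoOrbits cU (card-resp (Symm.inverse 𝒰≃ℒ) cℒ) cℒ cO)) cO

-- Cutting a poset at a maximal element.

module Cut (R : FinPoset) (m a : Fin (FinPoset.size R)) where
  open FinPoset R
  open FinPosetProperties R

  infix 4 _≺′_ _≺′?_
  _≺′_ : Rel (Fin size) 0ℓ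
  x ≺′ y = x ≺ y × y ≢ m × ¬ (x ≡ a × y ≺ m)

  _≺′?_ : B.Decidable _≺′_
  x ≺′? y = x ≺? y ×-dec ¬? (y Fin.≟ m) ×-dec ¬? (x Fin.≟ a ×-dec y ≺? m)

  -- If `x` is `a` and `z ≺ m`, then already `y ≺ m`, so the first of the two relations was deleted.
  ≺′-trans : B.Transitive _≺′_
  ≺′-trans (x≺y , y≢m , ¬xy) (y≺z , z≢m , ¬yz) =
    ≺-trans x≺y y≺z , z≢m , λ (x≡a , z≺m) → ¬xy (x≡a , ≺-trans y≺z z≺m)

  cut : FinPoset
  cut = record
    { size              = size
    ; _≼_               = λ x y → x ≡ y ⊎ x ≺′ y
    ; isDecPartialOrder = record
      { isPartialOrder = record
        { isPreorder = record
          { isEquivalence = isEquivalence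
          ; reflexive     = inj₁
          ; trans         = λ
            { (inj₁ refl) r           → r
            ; (inj₂ p)    (inj₁ refl) → inj₂ p
            ; (inj₂ p)    (inj₂ r)    → inj₂ (≺′-trans p r)
            }
          }
        ; antisym = λ
          { (inj₁ x≡y) _                         → x≡y
          ; (inj₂ _)         (inj₁ y≡x)          → sym y≡x
          ; (inj₂ (x≺y , _)) (inj₂ (y≺x , _)) → contradiction (≺-trans x≺y y≺x) ≺-irrefl
          }
        }
      ; _≟_  = Fin._≟_
      ; _≤?_ = λ x y → x Fin.≟ y ⊎-dec x ≺′? y
      }
    }

  ≺-cut⇒≺′ : ∀ {x y} → FinPoset._≺_ cut x y → x ≺′ y
  ≺-cut⇒≺′ (inj₁ x≡y , x≢y) = contradiction x≡y x≢y
  ≺-cut⇒≺′ (inj₂ p , _)     = p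

  ≺′⇒≺-cut : ∀ {x y} → x ≺′ y → FinPoset._≺_ cut x y
  ≺′⇒≺-cut p@((_ , x≢y) , _) = inj₂ p , x≢y

module CutStep (R : FinPoset) {m a : Fin (FinPoset.size R)}
               (m∈max : _∈max R m) (a≺m : FinPoset._≺_ R a m) where
  open FinPoset R
  open FinPosetProperties R
  open Cut R m a

  m⊀ : ∀ {x} → ¬ m ≺ x
  m⊀ (m≼x , m≢x) = m≢x (sym (m∈max _ m≼x))

  system : PosetSystem R
  system = record
    { m           = m
    ; m∈max       = m∈max
    ; A           = ⁅ a ⁆
    ; A⊆lb        = λ x∈A → subst (_≺ m) (sym (x∈⁅y⁆⇒x≡y a x∈A)) a≺m
    ; isAntichain = λ x∈A y∈A _ → trans (x∈⁅y⁆⇒x≡y a x∈A) (sym (x∈⁅y⁆⇒x≡y a y∈A))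
    }

  module _ {q : ℕ} (F : FiniteField q) where
    open FiniteField F
    open FieldCounting F
    open Matrices F
    open MatrixAlgebra F
    open Classes F
    open PatternGroup R F
    open Unitriangular R F
    open SystemOrbits system F
    open Sum +-commutativeMonoid using (sum-syntax; sum-cong-≗)
    private
      module G′ = PatternGroup cut F
      module U′ = Unitriangular cut F
      module O′ = CoadjointOrbits cut F
      module Q  = PatternGroup (star R m) F

    -- Row `m` of `𝟙A` is written as row `a` of the identity, so that multiplying it by `inv g`
    -- visibly gives row `a` of `inv g`.
    Row : Pred (Matrix size) 0ℓ
    Row L = ∀ j → j ≺ m → L m j ≡ 𝟙 a j

    𝟙A-row : ∀ j → 𝟙A m j ≡ 𝟙 a j
    𝟙A-row j = cong (if_then 1# else 0#) (does-⇔ record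
      { to = λ (_ , j∈A) → sym (x∈⁅y⁆⇒x≡y a j∈A) ; from = λ { refl → refl , x∈⁅x⁆ a } ; to-cong = λ { refl → refl } ; from-cong = λ { refl → refl } }
      (m Fin.≟ m ×-dec j ∈? ⁅ a ⁆) (a Fin.≟ j))

    row⇒ : ∀ {L} → Row L → L Q.≈ℒ 𝟙A
    row⇒ row i j (inj₁ j≡i , j≢i)        = contradiction j≡i j≢i
    row⇒ row i j (inj₂ (refl , j≺m) , _) = trans (row j j≺m) (sym (𝟙A-row j))

    ⇒row : ∀ {L} → L Q.≈ℒ 𝟙A → Row L
    ⇒row e j j≺m = trans (e m j (inj₂ (refl , j≺m) , proj₂ j≺m)) (𝟙A-row j)

    Row-resp : ∀ {L L′} → L ≈ L′ → Row L → Row L′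
    Row-resp e row j j≺m = trans (sym (e m j)) (row j j≺m)

    -- Maximality of `m` makes row `m` of `g` an identity row, so left multiplication leaves row `m`
    -- of `L` alone. On the right `inv g` is upper triangular, so only columns `l ≼ j` enter, where
    -- `Row` prescribes `L m l`.
    row-conj : ∀ g {L} → Row L → ∀ j → j ≺ m → conj g L m j ≡ inv g a j
    row-conj g {L} row j j≺m = begin
      (mat g · L · inv g) m j               ≡⟨ sum-cong-≗ (λ l → cong (_* inv g l j) (row-m l)) ⟩
      ∑[ l < size ] (L m l * inv g l j)     ≡⟨ sum-cong-≗ term ⟩
      (𝟙 · inv g) a j                       ≡⟨ ·-identityˡ (inv g) a j ⟩
      inv g a j                             ∎
      where
      open ≡-Reasoning
      row-m : ∀ l → (mat g · L) m l ≡ L m l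
      row-m l = trans (sum-cong-≗ (λ k → cong (_* L k l) (uni g m k m⊀))) (·-identityˡ L m l)

      term : ∀ l → L m l * inv g l j ≡ 𝟙 a l * inv g l j
      term l with l ≼? j
      ... | yes l≼j = cong (_* inv g l j) (row l (≼-≺-trans l≼j j≺m))
      ... | no  l⋠j = trans (cong (L m l *_) z) (trans (zeroʳ _) (sym (trans (cong (𝟙 a l *_) z) (zeroʳ _))))
        where z = Uni⇒Upper (inv-uni g) l j l⋠j

    -- Phrased through `inv g`, as `row-conj` delivers it; `stab-⁻¹` yields the same condition on
    -- `mat g`.
    Stabilises : Pred U 0ℓ
    Stabilises g = ∀ j → j ≺ m → inv g a j ≡ 𝟙 a j

    stab⇒ : ∀ g {L} → Row L → Row (conj g L) → Stabilises g
    stab⇒ g row row′ j j≺m = trans (sym (row-conj g row j j≺m)) (row′ j j≺m)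

    ⇒stab : ∀ g {L} → Row L → Stabilises g → Row (conj g L)
    ⇒stab g row stab j j≺m = trans (row-conj g row j j≺m) (stab j j≺m)

    row-𝟙A : Row 𝟙A
    row-𝟙A j _ = 𝟙A-row j

    inStab⇒ : ∀ g → InStab g → Stabilises g
    inStab⇒ g p = stab⇒ g row-𝟙A (⇒row p)

    ⇒inStab : ∀ g → Stabilises g → InStab g
    ⇒inStab g stab = row⇒ (⇒stab g row-𝟙A stab)

    conj-⁻¹ : ∀ g L → conj (g ⁻¹ᵁ) (conj g L) ≈ L
    conj-⁻¹ g L = ≈-trans (≈-sym (conj-∙ (g ⁻¹ᵁ) g L)) (≈-trans (conj-congˡ (g ⁻¹ᵁ ∙ᵁ g) εᵁ L (inverseˡ g)) (conj-ε L))

    stab-⁻¹ : ∀ g → Stabilises g → Stabilises (g ⁻¹ᵁ)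
    stab-⁻¹ g stab = stab⇒ (g ⁻¹ᵁ) {conj g 𝟙A} (⇒stab g row-𝟙A stab)
      (Row-resp (≈-sym (conj-⁻¹ g 𝟙A)) row-𝟙A)

    sameOrbit-isEquivalence : IsEquivalence SameOrbit
    sameOrbit-isEquivalence = record
      { refl  = λ {L} → εᵁ , ⇒inStab εᵁ (λ _ _ → refl) , ≈⇒≈ℒ (conj-ε L)
      ; sym   = λ {L} (g , s , p) → g ⁻¹ᵁ , ⇒inStab (g ⁻¹ᵁ) (stab-⁻¹ g (inStab⇒ g s)) ,
                  Setoid.trans ℒ (conj-≈ℒ (g ⁻¹ᵁ) (Setoid.sym ℒ p)) (≈⇒≈ℒ (conj-⁻¹ g L))
      ; trans = λ {L} (g , s , p) (h , t , r) → h ∙ᵁ g ,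
                  ⇒inStab (h ∙ᵁ g) (stab⇒ (h ∙ᵁ g) row-𝟙A (Row-resp (≈-sym (conj-∙ h g 𝟙A))
                    (⇒stab h (⇒stab g row-𝟙A (inStab⇒ g s)) (inStab⇒ h t)))) ,
                  Setoid.trans ℒ (≈⇒≈ℒ (conj-∙ h g L)) (Setoid.trans ℒ (conj-≈ℒ h p) r)
      }

    -- It differs from the identity only in column `m`. For `c` supported below `m` the coefficients
    -- of a product add up, which gives the inverse.
    shear : (Fin size → Carrier) → Matrix size
    shear c i j = 𝟙 i j + c i * 𝟙 m j

    shear-· : ∀ c N i j → (shear c · N) i j ≡ N i j + c i * N m j
    shear-· c N i j = trans (·-distribʳ-⊕ N 𝟙 (λ i j → c i * 𝟙 m j) i j) (cong₂ _+_ (·-identityˡ N i j)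
      (trans (sum-cong-≗ (λ k → *-assoc (c i) (𝟙 m k) (N k j)))
        (trans (sym (*-distribˡ-∑ (c i) (λ k → 𝟙 m k * N k j))) (cong (c i *_) (·-identityˡ N m j)))))

    ·-shear : ∀ c N i j → j ≢ m → (N · shear c) i j ≡ N i j
    ·-shear c N i j j≢m = trans (sum-cong-≗ (λ k → cong (N i k *_) (trans
        (cong (λ x → 𝟙 k j + c k * x) (𝟙-off-diagonal m j (j≢m ∘ sym)))
        (trans (cong (𝟙 k j +_) (zeroʳ (c k))) (+-identityʳ _))))) (·-identityʳ N i j)

    module _ (c : Fin size → Carrier) (c-supp : ∀ i → ¬ i ≺ m → c i ≡ 0#) where
      shear-uni : Uni (shear c)
      shear-uni i j i⊀j = trans (cong (𝟙 i j +_) zero-term) (+-identityʳ _)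
        where
        zero-term : c i * 𝟙 m j ≡ 0#
        zero-term with m Fin.≟ j
        ... | yes refl = trans (cong (_* 1#) (c-supp i i⊀j)) (zeroˡ _)
        ... | no  _    = zeroʳ _

      shear-inverse : ∀ d → (∀ i → c i + d i ≡ 0#) → shear c · shear d ≈ 𝟙
      shear-inverse d c+d≡0 i j = begin
        (shear c · shear d) i j                               ≡⟨ shear-· c (shear d) i j ⟩
        (𝟙 i j + d i * 𝟙 m j) + c i * (𝟙 m j + d m * 𝟙 m j) ≡⟨ cong (λ x → (𝟙 i j + d i * 𝟙 m j) + c i * x)
                                                                   (trans (cong (λ x → 𝟙 m j + x * 𝟙 m j) dm≡0)
                                                                     (trans (cong (𝟙 m j +_) (zeroˡ _)) (+-identityʳ _))) ⟩
        (𝟙 i j + d i * 𝟙 m j) + c i * 𝟙 m j                 ≡⟨ +-assoc _ _ _ ⟩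
        𝟙 i j + (d i * 𝟙 m j + c i * 𝟙 m j)                 ≡⟨ cong (𝟙 i j +_) (distribʳ (𝟙 m j) (d i) (c i)) ⟨
        𝟙 i j + (d i + c i) * 𝟙 m j                          ≡⟨ cong (λ x → 𝟙 i j + x * 𝟙 m j) (trans (+-comm (d i) (c i)) (c+d≡0 i)) ⟩
        𝟙 i j + 0# * 𝟙 m j                                   ≡⟨ trans (cong (𝟙 i j +_) (zeroˡ _)) (+-identityʳ _) ⟩
        𝟙 i j                                                 ∎
        where
        open ≡-Reasoning
        dm≡0 : d m ≡ 0#
        dm≡0 = trans (sym (trans (cong (_+ d m) (c-supp m m⊀)) (+-identityˡ _))) (c+d≡0 m)

    Shear : (c : Fin size → Carrier) → (∀ i → ¬ i ≺ m → c i ≡ 0#) → U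
    Shear c c-supp = record
      { mat      = shear c
      ; inv      = shear (-_ ∘ c)
      ; mat∈U    = Uni⇒InU (shear-uni c c-supp)
      ; inverseʳ = shear-inverse c c-supp (-_ ∘ c) (λ i → -‿inverseʳ (c i))
      ; inverseˡ = shear-inverse (-_ ∘ c) (λ i p → trans (cong -_ (c-supp i p)) -0≡0) c (λ i → -‿inverseˡ (c i))
      }
      where
      -0≡0 : - 0# ≡ 0#
      -0≡0 = trans (sym (+-identityˡ _)) (-‿inverseʳ 0#)

    conj-Shear : ∀ c c-supp L i j → j ≢ m → conj (Shear c c-supp) L i j ≡ L i j + c i * L m j
    conj-Shear c c-supp L i j j≢m = trans (·-shear (-_ ∘ c) (shear c · L) i j j≢m) (shear-· c L i j)

    ≺⇒≢m : ∀ {i j} → j ≺ i → j ≢ m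
    ≺⇒≢m j≺i refl = m⊀ j≺i

    conj-Shear-≈ℒ′ : ∀ c c-supp {L} → Row L → conj (Shear c c-supp) L G′.≈ℒ L
    conj-Shear-≈ℒ′ c c-supp {L} row i j j≺′i = trans (conj-Shear c c-supp L i j (≺⇒≢m j≺i))
      (trans (cong (L i j +_) zero-term) (+-identityʳ _))
      where
      j≺i = proj₁ (≺-cut⇒≺′ j≺′i)
      zero-term : c i * L m j ≡ 0#
      zero-term with i ≺? m
      ... | yes i≺m = trans (cong (c i *_) (trans (row j (≺-trans j≺i i≺m))
                        (𝟙-off-diagonal a j λ { refl → proj₂ (proj₂ (≺-cut⇒≺′ j≺′i)) (refl , i≺m) }))) (zeroʳ _)
      ... | no  i⊀m = trans (cong (_* L m j) (c-supp i i⊀m)) (zeroˡ _)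

    ≈ℒ⇒≈ℒ′ : ∀ {L L′} → L ≈ℒ L′ → L G′.≈ℒ L′
    ≈ℒ⇒≈ℒ′ e i j j≺′i = e i j (proj₁ (≺-cut⇒≺′ j≺′i))

    -- The shear clears column m of g; on the fibre it only moves entries
    -- (i , a) with a ≺ i ≺ m, which the cut forgets.
    restrict : ∀ g → Stabilises g → Σ[ h ∈ G′.U ] (∀ {L} → Row L → G′.conj h L G′.≈ℒ conj g L)
    restrict g stab = record
      { mat = mat h ; inv = inv h ; mat∈U = U′.Uni⇒InU h-uni ; inverseʳ = inverseʳ h ; inverseˡ = inverseˡ h } ,
      λ {L} row → Setoid.trans G′.ℒ (U′.≈⇒≈ℒ (conj-∙ (Shear c c-supp) g L)) (conj-Shear-≈ℒ′ c c-supp (⇒stab g row stab))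
      where
      c : Fin size → Carrier
      c i = 𝟙 i m - mat g i m

      c-supp : ∀ i → ¬ i ≺ m → c i ≡ 0#
      c-supp i i⊀m = x≡y⇒x-y≡0 (sym (uni g i m i⊀m))

      h : U
      h = Shear c c-supp ∙ᵁ g

      h-entry : ∀ i j → mat h i j ≡ mat g i j + c i * 𝟙 m j
      h-entry i j = trans (shear-· c (mat g) i j) (cong (λ x → mat g i j + c i * x) (uni g m j m⊀))

      h-uni : U′.Uni (mat h)
      h-uni i j i⊀′j with j Fin.≟ m
      ... | yes refl = trans (h-entry i m) (trans (cong (λ x → mat g i m + c i * x) (𝟙-diagonal m))
                         (trans (cong (mat g i m +_) (*-identityʳ (c i))) (trans (+-comm _ _) (sym (⊖-⊕ 𝟙 (mat g) i m)))))
      ... | no j≢m = trans (h-entry i j) (trans (cong (λ x → mat g i j + c i * x) (𝟙-off-diagonal m j (j≢m ∘ sym)))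
                         (trans (cong (mat g i j +_) (zeroʳ _)) (trans (+-identityʳ _) entry)))
        where
        entry : mat g i j ≡ 𝟙 i j
        entry with i ≺? j | i Fin.≟ a ×-dec j ≺? m
        ... | no i⊀j  | _                 = uni g i j i⊀j
        -- `inv (g ⁻¹ᵁ)` is `mat g`, so stability of the inverse is a statement about row `a` of `g`
        -- itself.
        ... | yes _   | yes (refl , j≺m) = stab-⁻¹ g stab j j≺m
        ... | yes i≺j | no ¬ij            = contradiction (≺′⇒≺-cut (i≺j , j≢m , ¬ij)) i⊀′j

    -- A lift into the fibre. No relation of the cut poset ends in `m`, so its ℒ does not see row
    -- `m`, which is free to carry the prescribed values.
    fill : Matrix size → Matrix size
    fill L i j = if does (i Fin.≟ m) then 𝟙 a j else L i j

    fill-row : ∀ L → Row (fill L)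
    fill-row L j _ = cong (if_then 𝟙 a j else L m j) (dec-true (m Fin.≟ m) refl)

    fill-other : ∀ L {i} j → i ≢ m → fill L i j ≡ L i j
    fill-other L {i} j i≢m = cong (if_then 𝟙 a j else L i j) (dec-false (i Fin.≟ m) i≢m)

    fill-≈ℒ′ : ∀ L → fill L G′.≈ℒ L
    fill-≈ℒ′ L i j j≺′i = fill-other L j (proj₁ (proj₂ (≺-cut⇒≺′ j≺′i)))

    fill-fibre : ∀ {L} → Row L → fill L ≈ℒ L
    fill-fibre {L} row i j j≺i with i Fin.≟ m
    ... | yes refl = sym (row j j≺i)
    ... | no  _    = refl

    -- The two fillings may still differ at the entries (i , a), a ≺ i ≺ m; the
    -- shear with coefficients N i a - M i a corrects them.
    extend : ∀ h {L L′} → G′.conj h L G′.≈ℒ L′ → SameOrbit (fill L) (fill L′)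
    extend h {L} {L′} hL≈L′ = g , ⇒inStab g (stab⇒ g (fill-row L) (Row-resp (≈-sym gL≈) row-T)) ,
      Setoid.trans ℒ (≈⇒≈ℒ gL≈) T-≈ℒ
      where
      ⊀⇒⊀′ : ∀ {i j} → ¬ i ≺ j → ¬ FinPoset._≺_ cut i j
      ⊀⇒⊀′ i⊀j = i⊀j ∘ proj₁ ∘ ≺-cut⇒≺′

      h′ : U
      h′ = record { mat = mat h ; inv = inv h ; mat∈U = Uni⇒InU (λ i j i⊀j → U′.uni h i j (⊀⇒⊀′ i⊀j))
                  ; inverseʳ = inverseʳ h ; inverseˡ = inverseˡ h }
        where open G′ using (mat; inv; inverseʳ; inverseˡ)

      h′-stab : Stabilises h′
      h′-stab j j≺m = U′.inv-uni h a j (λ p → proj₂ (proj₂ (≺-cut⇒≺′ p)) (refl , j≺m))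

      M N : Matrix size
      M = conj h′ (fill L)
      N = fill L′

      M-row : Row M
      M-row = ⇒stab h′ (fill-row L) h′-stab

      M≈ℒ′N : M G′.≈ℒ N
      M≈ℒ′N = Setoid.trans G′.ℒ (U′.conj-≈ℒ h (fill-≈ℒ′ L))
                (Setoid.trans G′.ℒ hL≈L′ (Setoid.sym G′.ℒ (fill-≈ℒ′ L′)))

      c : Fin size → Carrier
      -- The default `0#` keeps the shear in the group. For `i ≺ m` without `a ≺ i` the coefficient
      -- may be nonzero, but it then changes no entry that ℒ sees.
      c i = if does (i ≺? m) then N i a - M i a else 0#

      c-supp : ∀ i → ¬ i ≺ m → c i ≡ 0#
      c-supp i i⊀m = cong (if_then N i a - M i a else 0#) (dec-false (i ≺? m) i⊀m)

      g : U
      g = Shear c c-supp ∙ᵁ h′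

      gL≈ : conj g (fill L) ≈ conj (Shear c c-supp) M
      gL≈ = conj-∙ (Shear c c-supp) h′ (fill L)

      row-T : Row (conj (Shear c c-supp) M)
      row-T j j≺m = trans (conj-Shear c c-supp M m j (≺⇒≢m j≺m))
        (trans (cong (M m j +_) (trans (cong (_* M m j) (c-supp m m⊀)) (zeroˡ _))) (trans (+-identityʳ _) (M-row j j≺m)))

      T-≈ℒ : conj (Shear c c-supp) M ≈ℒ N
      T-≈ℒ i j j≺i = entry i j j≺i (i Fin.≟ m) (j Fin.≟ a ×-dec i ≺? m)
        where
        entry : ∀ i j → j ≺ i → Dec (i ≡ m) → Dec (j ≡ a × i ≺ m) → conj (Shear c c-supp) M i j ≡ N i j
        entry i j j≺i (yes refl) _        = trans (row-T j j≺i) (sym (fill-row L′ j j≺i))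
        entry i j j≺i (no i≢m)   (no ¬ji) = trans (conj-Shear-≈ℒ′ c c-supp M-row i j j≺′i) (M≈ℒ′N i j j≺′i)
          where j≺′i = ≺′⇒≺-cut (j≺i , i≢m , ¬ji)
        entry i j j≺i (no i≢m) (yes (refl , i≺m)) = begin
            conj (Shear c c-supp) M i a     ≡⟨ conj-Shear c c-supp M i a (≺⇒≢m j≺i) ⟩
            M i a + c i * M m a             ≡⟨ cong₂ (λ x y → M i a + x * y) (cong (if_then N i a - M i a else 0#) (dec-true (i ≺? m) i≺m))
                                                 (trans (M-row a a≺m) (𝟙-diagonal a)) ⟩
            M i a + (N i a - M i a) * 1#    ≡⟨ cong (M i a +_) (*-identityʳ _) ⟩
            M i a + (N i a - M i a)         ≡⟨ trans (+-comm _ _) (sym (⊖-⊕ N M i a)) ⟩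
            N i a                           ∎
          where open ≡-Reasoning

    -- Forgetting the fibre condition and `fill` are inverse to each other; `restrict` and `extend`
    -- carry group elements across, so both maps respect orbits.
    kₛ≡k-cut : kₛ system F ≡ k cut F
    kₛ≡k-cut = card-unique
      (card-#classes InFibre? SameOrbit? sameOrbit-isEquivalence
        (λ e → εᵁ , ⇒inStab εᵁ (λ _ _ → refl) , ≈⇒≈ℒ (≈-trans (conj-ε _) e))
        (λ e fibre → row⇒ (Row-resp e (⇒row fibre))))
      (card-resp (Symm.inverse fibre≃) O′.card-CoOrbits)
      where
      fibre≃ : Sub (record { isEquivalence = sameOrbit-isEquivalence }) InFibre ≃ O′.CoOrbits
      fibre≃ = mk≃ (Sub _ InFibre) O′.CoOrbits
        proj₁ (λ L → fill L , row⇒ (fill-row L))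
        (λ {(L , fibre)} (g , s , p) → let (h , hL≈gL) = restrict g (inStab⇒ g s) in
          h , Setoid.trans G′.ℒ (hL≈gL (⇒row fibre)) (≈ℒ⇒≈ℒ′ p))
        (λ (h , p) → extend h p)
        (λ L → U′.εᵁ , Setoid.trans G′.ℒ (U′.≈⇒≈ℒ (U′.conj-ε (fill L))) (fill-≈ℒ′ L))
        (λ (L , fibre) → εᵁ , ⇒inStab εᵁ (λ _ _ → refl) ,
          Setoid.trans ℒ (≈⇒≈ℒ (conj-ε (fill L))) (fill-fibre (⇒row fibre)))

-- Discarding isolated points.

module Core (P R : FinPoset) (f : Fin (FinPoset.size P) → Fin (FinPoset.size R))
            (f-injective : Injective _≡_ _≡_ f)
            (f-mono   : ∀ {i j} → FinPoset._≺_ P i j → FinPoset._≺_ R (f i) (f j))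
            (f-cancel : ∀ {i j} → FinPoset._≺_ R (f i) (f j) → FinPoset._≺_ P i j)
            (≺-image  : ∀ {x y} → FinPoset._≺_ R x y → (∃[ i ] f i ≡ x) × (∃[ j ] f j ≡ y))
            {q : ℕ} (F : FiniteField q) where
  private
    module P = FinPoset P
    module R = FinPoset R
  open FiniteField F
  open FieldCounting F
  open Matrices F
  open MatrixAlgebra F
  open Sum +-commutativeMonoid using (sum-syntax; sum-cong-≗; ∑-comm)
  private
    module GP = PatternGroup P F
    module GR = PatternGroup R F
    module UP = Unitriangular P F
    module UR = Unitriangular R F
    module OP = CoadjointOrbits P F
    module OR = CoadjointOrbits R F

  Image : Pred (Fin R.size) 0ℓ
  Image x = ∃[ i ] f i ≡ x

  image? : Decidable Image
  image? x = Fin.any? (λ i → f i Fin.≟ x)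

  -- Insert the indicator of `f i ≡ x` and exchange the sums: by injectivity exactly one `i`
  -- contributes for each `x` in the image.
  ∑-image : (h : Fin R.size → Carrier) → (∀ x → ¬ Image x → h x ≡ 0#) →
            ∑[ x < R.size ] h x ≡ ∑[ i < P.size ] h (f i)
  ∑-image h h≡0 = begin
    ∑[ x < R.size ] h x                                     ≡⟨ sum-cong-≗ expand ⟩
    ∑[ x < R.size ] ∑[ i < P.size ] (𝟙 (f i) x * h x)      ≡⟨ ∑-comm (λ x i → 𝟙 (f i) x * h x) ⟩
    ∑[ i < P.size ] ∑[ x < R.size ] (𝟙 (f i) x * h x)      ≡⟨ sum-cong-≗ (λ i → ·-identityˡ (λ x _ → h x) (f i) (f i)) ⟩
    ∑[ i < P.size ] h (f i)                                 ∎
    where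
    open ≡-Reasoning
    expand : ∀ x → h x ≡ ∑[ i < P.size ] (𝟙 (f i) x * h x)
    expand x with image? x
    ... | yes (i , refl) = sym (trans
      (∑-single _ i (λ k k≢i → trans (cong (_* h (f i)) (𝟙-off-diagonal (f k) (f i) (k≢i ∘ f-injective))) (zeroˡ _)))
      (trans (cong (_* h (f i)) (𝟙-diagonal (f i))) (*-identityˡ _)))
    ... | no  x∉f = trans (h≡0 x x∉f) (sym (∑-zero _ (λ i → trans (cong (𝟙 (f i) x *_) (h≡0 x x∉f)) (zeroʳ _))))

  res : Matrix R.size → Matrix P.size
  res M i j = M (f i) (f j)

  res-𝟙 : res 𝟙 ≈ 𝟙
  res-𝟙 i j = cong (if_then 1# else 0#) (does-⇔ (mk⇔ f-injective (cong f)) (f i Fin.≟ f j) (i Fin.≟ j))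

  res-· : ∀ A B → (∀ (i j : Fin P.size) x → ¬ Image x → A (f i) x * B x (f j) ≡ 0#) → res (A · B) ≈ res A · res B
  res-· A B vanish i j = ∑-image (λ x → A (f i) x * B x (f j)) (vanish i j)

  -- By `≺-image` a point outside the image is comparable only to itself, so a unitriangular matrix
  -- has no entry leading from the image to it. Hence restriction to the image is multiplicative.
  row-vanishes : ∀ {A} (B : Matrix R.size) → UR.Uni A → ∀ (i j : Fin P.size) x → ¬ Image x → A (f i) x * B x (f j) ≡ 0#
  row-vanishes {A} B uni i j x x∉f = trans (cong (_* B x (f j)) (trans (uni (f i) x (x∉f ∘ proj₂ ∘ ≺-image))
    (𝟙-off-diagonal (f i) x (λ e → x∉f (i , e))))) (zeroˡ _)

  column-vanishes : ∀ (A : Matrix R.size) {B} → UR.Uni B → ∀ (i j : Fin P.size) x → ¬ Image x → A (f i) x * B x (f j) ≡ 0#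
  column-vanishes A {B} uni i j x x∉f = trans (cong (A (f i) x *_) (trans (uni x (f j) (x∉f ∘ proj₁ ∘ ≺-image))
    (𝟙-off-diagonal x (f j) (λ e → x∉f (j , sym e))))) (zeroʳ _)

  res-inverse : ∀ {A B} → UR.Uni A → A · B ≈ 𝟙 → res A · res B ≈ 𝟙
  res-inverse {A} {B} uni AB≈𝟙 = ≈-trans (≈-sym (res-· A B (row-vanishes B uni)))
    (≈-trans (λ i j → AB≈𝟙 (f i) (f j)) res-𝟙)

  res-uni : ∀ {A} → UR.Uni A → UP.Uni (res A)
  res-uni uni i j i⊀j = trans (uni (f i) (f j) (i⊀j ∘ f-cancel)) (res-𝟙 i j)

  resᵁ : GR.U → GP.U
  resᵁ g = record
    { mat      = res (GR.mat g)
    ; inv      = res (GR.inv g)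
    ; mat∈U    = UP.Uni⇒InU (res-uni (UR.uni g))
    ; inverseʳ = res-inverse (UR.uni g) (GR.inverseʳ g)
    ; inverseˡ = res-inverse (UR.inv-uni g) (GR.inverseˡ g)
    }

  res-conj : ∀ g L → res (GR.conj g L) ≈ GP.conj (resᵁ g) (res L)
  res-conj g L = ≈-trans (res-· (mat · L) inv (column-vanishes (mat · L) (UR.inv-uni g)))
    (·-cong (res-· mat L (row-vanishes L (UR.uni g))) (≈-refl {M = res inv}))
    where
    mat = GR.mat g
    inv = GR.inv g

  -- The decisions are arguments so that proofs can match on them. The value `𝟙` off the image is
  -- what group elements require; when the matrix stands for a class in ℒ, those entries are
  -- invisible.
  ext′ : Matrix P.size → ∀ x y → Dec (Image x) → Dec (Image y) → Carrier
  ext′ G x y (yes (i , _)) (yes (j , _)) = G i j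
  ext′ G x y (no _)        _             = 𝟙 x y
  ext′ G x y (yes _)       (no _)        = 𝟙 x y

  ext : Matrix P.size → Matrix R.size
  ext G x y = ext′ G x y (image? x) (image? y)

  res-ext : ∀ G → res (ext G) ≈ G
  res-ext G i j = go (image? (f i)) (image? (f j))
    where
    go : (d : Dec (Image (f i))) (e : Dec (Image (f j))) → ext′ G (f i) (f j) d e ≡ G i j
    go (yes (i′ , p)) (yes (j′ , r)) = cong₂ G (f-injective p) (f-injective r)
    go (no ¬p)        _              = contradiction (i , refl) ¬p
    go (yes _)        (no ¬r)        = contradiction (j , refl) ¬r

  ext-outside : ∀ G x y → ¬ (Image x × Image y) → ext G x y ≡ 𝟙 x y
  ext-outside G x y ¬xy = go (image? x) (image? y)
    where
    go : (d : Dec (Image x)) (e : Dec (Image y)) → ext′ G x y d e ≡ 𝟙 x y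
    go (yes p) (yes r) = contradiction (p , r) ¬xy
    go (no _)  _       = refl
    go (yes _) (no _)  = refl

  ext-uni : ∀ {G} → UP.Uni G → UR.Uni (ext G)
  ext-uni {G} uni x y x⊀y with image? x ×-dec image? y
  ... | no ¬xy = ext-outside G x y ¬xy
  ... | yes ((i , refl) , (j , refl)) = trans (res-ext G i j) (trans (uni i j (x⊀y ∘ f-mono)) (sym (res-𝟙 i j)))

  ext-inverse : ∀ {G H} → UP.Uni G → G · H ≈ 𝟙 → ext G · ext H ≈ 𝟙
  ext-inverse {G} {H} uni GH≈𝟙 x y = go (image? x) (image? y)
    where
    go : Dec (Image x) → Dec (Image y) → (ext G · ext H) x y ≡ 𝟙 x y
    go (no x∉f) _        = trans (sum-cong-≗ (λ z → cong (_* ext H z y) (ext-outside G x z (x∉f ∘ proj₁))))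
                       (trans (·-identityˡ (ext H) x y) (ext-outside H x y (x∉f ∘ proj₁)))
    go (yes _)  (no y∉f) = trans (sum-cong-≗ (λ z → cong (ext G x z *_) (ext-outside H z y (y∉f ∘ proj₂))))
                       (trans (·-identityʳ (ext G) x y) (ext-outside G x y (y∉f ∘ proj₂)))
    go (yes (i , refl)) (yes (j , refl)) = trans (res-· (ext G) (ext H) (row-vanishes (ext H) (ext-uni uni)) i j)
                       (trans (·-cong (res-ext G) (res-ext H) i j) (trans (GH≈𝟙 i j) (sym (res-𝟙 i j))))

  extᵁ : GP.U → GR.U
  extᵁ g = record
    { mat      = ext (GP.mat g)
    ; inv      = ext (GP.inv g)
    ; mat∈U    = UR.Uni⇒InU (ext-uni (UP.uni g))
    ; inverseʳ = ext-inverse (UP.uni g) (GP.inverseʳ g)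
    ; inverseˡ = ext-inverse (UP.inv-uni g) (GP.inverseˡ g)
    }

  res-≈ℒ : ∀ {L L′} → L GR.≈ℒ L′ → res L GP.≈ℒ res L′
  res-≈ℒ e i j j≺i = e (f i) (f j) (f-mono j≺i)

  ≈ℒ-from-res : ∀ {L L′} → res L GP.≈ℒ res L′ → L GR.≈ℒ L′
  ≈ℒ-from-res e x y y≺x with ≺-image y≺x
  ... | (j , refl) , (i , refl) = e i j (f-cancel y≺x)

  res-conj-ext : ∀ g L → res (GR.conj (extᵁ g) L) ≈ GP.conj g (res L)
  res-conj-ext g L = ≈-trans (res-conj (extᵁ g) L) (GP.conj-cong (res L) (res-ext (GP.mat g)) (res-ext (GP.inv g)))

  -- Both numbers are counted by coadjoint orbits: ℒ sees only entries inside the order, and on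
  -- these `res` and `ext` are inverse to each other.
  k-core : k R F ≡ k P F
  k-core = card-unique OR.card-CoOrbits (card-resp
    (mk≃ OP.CoOrbits OR.CoOrbits ext res
      (λ {L} {L′} (g , p) → extᵁ g , ≈ℒ-from-res (Setoid.trans GP.ℒ
        (UP.≈⇒≈ℒ (≈-trans (res-conj-ext g (ext L)) (UP.conj-congʳ g (res-ext L))))
        (Setoid.trans GP.ℒ p (UP.≈⇒≈ℒ (≈-sym (res-ext L′))))))
      (λ {L} (g , p) → resᵁ g , Setoid.trans GP.ℒ (UP.≈⇒≈ℒ (≈-sym (res-conj g L))) (res-≈ℒ p))
      (λ L → UR.εᵁ , Setoid.trans GR.ℒ (UR.≈⇒≈ℒ (UR.conj-ε (ext (res L)))) (≈ℒ-from-res (UP.≈⇒≈ℒ (res-ext (res L)))))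
      (λ L → UP.εᵁ , UP.≈⇒≈ℒ (≈-trans (UP.conj-ε (res (ext L))) (res-ext L))))
    OP.card-CoOrbits)

-- Embeddings as nonempty paths.

data _⇝⁺_ : FinPoset → FinPoset → Set₁ where
  single : ∀ {P Q} (S : PosetSystem Q) → (∀ {q} (F : FiniteField q) → k P F ≡ kₛ S F) → P ⇝⁺ Q
  step : ∀ {P R Q} (S : PosetSystem R) → (∀ {q} (F : FiniteField q) → k P F ≡ kₛ S F) → R ⇝⁺ Q → P ⇝⁺ Q

len : ∀ {P Q} → P ⇝⁺ Q → ℕ
len (single _ _)   = 1
len (step _ _ c) = suc (len c)

posets : ∀ {P Q} (c : P ⇝⁺ Q) → Fin (suc (len c)) → FinPoset
posets {P} c           zero    = P
posets {Q = Q} (single _ _) (suc _) = Q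
posets (step _ _ c)     (suc i) = posets c i

systems : ∀ {P Q} (c : P ⇝⁺ Q) (i : Fin (len c)) → PosetSystem (posets c (suc i))
systems (single S _)   zero    = S
systems (step S _ c) zero    = S
systems (step _ _ c) (suc i) = systems c i

posets-last : ∀ {P Q} (c : P ⇝⁺ Q) → posets c (fromℕ (len c)) ≡ Q
posets-last (single _ _)   = refl
posets-last (step _ _ c) = posets-last c

posets-k : ∀ {P Q} (c : P ⇝⁺ Q) i {q} (F : FiniteField q) → k (posets c (inject₁ i)) F ≡ kₛ (systems c i) F
posets-k (single _ e)   zero    = e
posets-k (step _ e c) zero    = e
posets-k (step _ _ c) (suc i) = posets-k c i

≅-refl : ∀ P → P ≅ P
≅-refl P = id , Identity.isOrderIsomorphism _≡_ (FinPoset._≼_ P) refl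

⇝⁺⇒⇝ : ∀ {P Q} → P ⇝⁺ Q → P ⇝ Q
⇝⁺⇒⇝ {P} {Q} c = record
  { n       = len c
  ; posets  = posets c
  ; systems = systems c
  ; first   = ≅-refl P
  ; last    = subst (_≅ Q) (sym (posets-last c)) (≅-refl Q)
  ; k≡kₛ    = posets-k c
  }

-- The source enters a path only through `k` in its first equation. Rewriting that equation replaces
-- the poset with isolated points by its core; this is why paths are nonempty.
change-source : ∀ {P R Q} → (∀ {q} (F : FiniteField q) → k R F ≡ k P F) → R ⇝⁺ Q → P ⇝⁺ Q
change-source e (single S e′)     = single S (λ F → trans (sym (e F)) (e′ F))
change-source e (step S e′ c) = step S (λ F → trans (sym (e F)) (e′ F)) c

-- Deciding the cuts by evaluation.

-- Strict orders on Fin n as Boolean functions of the labels: in this form the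
-- 46 cuts can be checked by evaluation.
Relᵇ : Set
Relᵇ = ℕ → ℕ → Bool

Represents : FinPoset → Relᵇ → Set
Represents R r = ∀ x y → (x ≺ y → T (r (toℕ x) (toℕ y))) × (T (r (toℕ x) (toℕ y)) → x ≺ y)
  where open FinPoset R

chain-represents : ∀ n → Represents (chain n) _<ᵇ_
chain-represents n x y =
  (λ (x≤y , x≢y) → ℕ.<⇒<ᵇ (ℕ.≤∧≢⇒< x≤y (x≢y ∘ Fin.toℕ-injective))) ,
  (λ p → let x<y = ℕ.<ᵇ⇒< (toℕ x) (toℕ y) p in ℕ.<⇒≤ x<y , λ { refl → ℕ.<-irrefl refl x<y })

cutᵇ : Relᵇ → ℕ → ℕ → Relᵇ
cutᵇ r m a x y = r x y ∧ not (y ≡ᵇ m) ∧ not ((x ≡ᵇ a) ∧ r y m)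

T-not : ∀ {b} → ¬ T b → T (not b)
T-not {false} _  = _
T-not {true}  ¬t = ¬t _

T-not⁻ : ∀ {b} → T (not b) → ¬ T b
T-not⁻ {false} _ ()

T-pair : ∀ {b c} → T b → T c → T (b ∧ c)
T-pair p r = Equivalence.from T-∧ (p , r)

T-split : ∀ {b c} → T (b ∧ c) → T b × T c
T-split = Equivalence.to T-∧

cut-represents : ∀ R m a {r} → Represents R r → Represents (Cut.cut R m a) (cutᵇ r (toℕ m) (toℕ a))
cut-represents R m a {r} rep x y = to , from
  where
  open Cut R m a
  to : FinPoset._≺_ cut x y → T (cutᵇ r (toℕ m) (toℕ a) (toℕ x) (toℕ y))
  to p = let (x≺y , y≢m , ¬xy) = ≺-cut⇒≺′ p in
    T-pair (proj₁ (rep x y) x≺y) (T-pair (T-not (y≢m ∘ Fin.toℕ-injective ∘ ℕ.≡ᵇ⇒≡ _ _))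
      (T-not (λ t → let (t₁ , t₂) = T-split t in ¬xy (Fin.toℕ-injective (ℕ.≡ᵇ⇒≡ _ _ t₁) , proj₂ (rep y m) t₂))))
  from : T (cutᵇ r (toℕ m) (toℕ a) (toℕ x) (toℕ y)) → FinPoset._≺_ cut x y
  from t = let (t₁ , t₂₃) = T-split {r (toℕ x) (toℕ y)} t
               (t₂ , t₃)  = T-split {not (toℕ y ≡ᵇ toℕ m)} t₂₃ in
    ≺′⇒≺-cut (proj₂ (rep x y) t₁ , (λ y≡m → T-not⁻ t₂ (ℕ.≡⇒≡ᵇ _ _ (cong toℕ y≡m))) ,
      λ (x≡a , y≺m) → T-not⁻ t₃ (T-pair (ℕ.≡⇒≡ᵇ _ _ (cong toℕ x≡a)) (proj₁ (rep y m) y≺m)))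

allᵇ : ∀ n → (Fin n → Bool) → Bool
allᵇ zero    p = true
allᵇ (suc n) p = p zero ∧ allᵇ n (p ∘ suc)

allᵇ⁻ : ∀ n (p : Fin n → Bool) → T (allᵇ n p) → ∀ i → T (p i)
allᵇ⁻ (suc n) p t zero    = proj₁ (T-split {p zero} t)
allᵇ⁻ (suc n) p t (suc i) = allᵇ⁻ n (p ∘ suc) (proj₂ (T-split {p zero} t)) i

admissible : ℕ → Relᵇ → ℕ → ℕ → Bool
admissible n r m a = (m <ᵇ n) ∧ (a <ᵇ n) ∧ r a m ∧ allᵇ n (λ y → not (r m (toℕ y)))

-- `R` is a nest of cuts; keeping `r` as an index lets the checks evaluate `r` on numerals without
-- unfolding the order of `R`.
record Cutting (n : ℕ) (Q : FinPoset) (r : Relᵇ) : Set₁ where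
  field
    R    : FinPoset
    size≡ : FinPoset.size R ≡ n
    rep  : Represents R r
    path : R ⇝⁺ Q

module _ (R : FinPoset) {r} (rep : Represents R r) (m a : ℕ)
         (adm : T (admissible (FinPoset.size R) r m a)) where
  open FinPoset R
  private
    adm₁ = T-split {m <ᵇ size} adm
    adm₂ = T-split {a <ᵇ size} (proj₂ adm₁)
    adm₃ = T-split {r a m} (proj₂ adm₂)
    m<   = ℕ.<ᵇ⇒< m size (proj₁ adm₁)
    a<   = ℕ.<ᵇ⇒< a size (proj₁ adm₂)

  mᶠ aᶠ : Fin size
  mᶠ = fromℕ< m<
  aᶠ = fromℕ< a<

  m∈max : _∈max R mᶠ
  m∈max x m≼x = decidable-stable (x Fin.≟ mᶠ) (λ x≢m →
    T-not⁻ (allᵇ⁻ size (λ y → not (r m (toℕ y))) (proj₂ adm₃) x)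
      (subst (λ z → T (r z (toℕ x))) (Fin.toℕ-fromℕ< m<) (proj₁ (rep mᶠ x) (m≼x , x≢m ∘ sym))))

  a≺m : aᶠ ≺ mᶠ
  a≺m = proj₂ (rep aᶠ mᶠ) (subst₂ (λ x y → T (r x y)) (sym (Fin.toℕ-fromℕ< a<)) (sym (Fin.toℕ-fromℕ< m<)) (proj₁ adm₃))

  cutℕ : FinPoset
  cutℕ = Cut.cut R mᶠ aᶠ

  cutℕ-represents : Represents cutℕ (cutᵇ r m a)
  cutℕ-represents = subst₂ (λ x y → Represents cutℕ (cutᵇ r x y)) (Fin.toℕ-fromℕ< m<) (Fin.toℕ-fromℕ< a<)
    (cut-represents R mᶠ aᶠ {r} rep)

  cutℕ-system : PosetSystem R
  cutℕ-system = CutStep.system R m∈max a≺m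

  k-cutℕ : ∀ {q} (F : FiniteField q) → k cutℕ F ≡ kₛ cutℕ-system F
  k-cutℕ F = sym (CutStep.kₛ≡k-cut R m∈max a≺m F)

Program : Set
Program = List (ℕ × ℕ)

run : Relᵇ → Program → Relᵇ
run r []            = r
run r ((m , a) ∷ p) = run (cutᵇ r m a) p

valid : ℕ → Relᵇ → Program → Bool
valid n r []            = true
valid n r ((m , a) ∷ p) = admissible n r m a ∧ valid n (cutᵇ r m a) p

module _ {n : ℕ} {Q : FinPoset} where
  -- Cutting leads down from the chain whereas a path is read from its source, so each new cut is
  -- put in front.
  cuts : ∀ {r} p → Cutting n Q r → T (valid n r p) → Cutting n Q (run r p)
  cuts []            c t = c
  cuts {r} ((m , a) ∷ p) record { R = R ; size≡ = refl ; rep = rep ; path = path } t =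
    let (adm , t′) = T-split {admissible n r m a} t in
    cuts p record
      { R = cutℕ R rep m a adm ; size≡ = refl ; rep = cutℕ-represents R rep m a adm
      ; path = step (cutℕ-system R rep m a adm) (k-cutℕ R rep m a adm) path } t′

-- The first cut is a separate argument because it forms the `single` end of the path, the one
-- adjacent to the chain.
cuts-chain : ∀ n m a p → T (valid n _<ᵇ_ ((m , a) ∷ p)) → Cutting n (chain n) (run _<ᵇ_ ((m , a) ∷ p))
cuts-chain n m a p t =
  let (adm , t′) = T-split {admissible n _<ᵇ_ m a} t
      rep = chain-represents n in
  cuts p record
    { R = cutℕ (chain n) rep m a adm ; size≡ = refl ; rep = cutℕ-represents (chain n) rep m a adm
    ; path = single (cutℕ-system (chain n) rep m a adm) (k-cutℕ (chain n) rep m a adm) } t′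

isCore : (P : FinPoset) (n : ℕ) → Relᵇ → (Fin (FinPoset.size P) → ℕ) → Bool
isCore P n r f =
  allᵇ size (λ i → f i <ᵇ n) ∧
  allᵇ size (λ i → allᵇ size (λ j → not (f i ≡ᵇ f j) ∨ ⌊ i Fin.≟ j ⌋)) ∧
  allᵇ size (λ i → allᵇ size (λ j → does (T? (r (f i) (f j)) →-dec i ≺? j))) ∧
  allᵇ size (λ i → allᵇ size (λ j → does (i ≺? j →-dec T? (r (f i) (f j))))) ∧
  allᵇ n (λ x → allᵇ n (λ y → does (T? (r (toℕ x) (toℕ y)) →-dec
    (Fin.any? (λ i → f i ℕ.≟ toℕ x) ×-dec Fin.any? (λ j → f j ℕ.≟ toℕ y)))))
  where open FinPoset P

T-does⁻ : ∀ {A : Set} (A? : Dec A) → T (does A?) → A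
T-does⁻ (yes a) _ = a

embedding : ∀ {n Q r} (P : FinPoset) (f : Fin (FinPoset.size P) → ℕ) →
            Cutting n Q r → T (isCore P n r f) → P ⇝ Q
embedding {n} {Q} {r} P f record { R = R ; size≡ = refl ; rep = rep ; path = path } t =
  ⇝⁺⇒⇝ (change-source (Core.k-core P R fᶠ injective mono cancel image) path)
  where
  module P = FinPoset P
  module R = FinPoset R
  t₁ = T-split {allᵇ P.size (λ i → f i <ᵇ n)} t
  t₂ = T-split {allᵇ P.size (λ i → allᵇ P.size (λ j → not (f i ≡ᵇ f j) ∨ ⌊ i Fin.≟ j ⌋))} (proj₂ t₁)
  t₃ = T-split {allᵇ P.size (λ i → allᵇ P.size (λ j → does (T? (r (f i) (f j)) →-dec i P.≺? j)))} (proj₂ t₂)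
  t₄ = T-split {allᵇ P.size (λ i → allᵇ P.size (λ j → does (i P.≺? j →-dec T? (r (f i) (f j)))))} (proj₂ t₃)

  f< : ∀ i → f i ℕ.< n
  f< i = ℕ.<ᵇ⇒< (f i) n (allᵇ⁻ P.size _ (proj₁ t₁) i)

  fᶠ : Fin P.size → Fin n
  fᶠ i = fromℕ< (f< i)

  toℕ-fᶠ : ∀ i → toℕ (fᶠ i) ≡ f i
  toℕ-fᶠ i = Fin.toℕ-fromℕ< (f< i)

  injective : ∀ {i j} → fᶠ i ≡ fᶠ j → i ≡ j
  injective {i} {j} e with Equivalence.to (T-∨ {not (f i ≡ᵇ f j)}) (allᵇ⁻ P.size _ (allᵇ⁻ P.size _ (proj₁ t₂) i) j)
  ... | inj₁ ≢ = contradiction (ℕ.≡⇒≡ᵇ _ _ (trans (sym (toℕ-fᶠ i)) (trans (cong toℕ e) (toℕ-fᶠ j)))) (T-not⁻ ≢)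
  ... | inj₂ p = toWitness p

  mono : ∀ {i j} → i P.≺ j → fᶠ i R.≺ fᶠ j
  mono {i} {j} i≺j = proj₂ (rep (fᶠ i) (fᶠ j)) (subst₂ (λ x y → T (r x y)) (sym (toℕ-fᶠ i)) (sym (toℕ-fᶠ j))
    (T-does⁻ (i P.≺? j →-dec T? (r (f i) (f j))) (allᵇ⁻ P.size _ (allᵇ⁻ P.size _ (proj₁ t₄) i) j) i≺j))

  cancel : ∀ {i j} → fᶠ i R.≺ fᶠ j → i P.≺ j
  cancel {i} {j} p = T-does⁻ (T? (r (f i) (f j)) →-dec i P.≺? j) (allᵇ⁻ P.size _ (allᵇ⁻ P.size _ (proj₁ t₃) i) j)
    (subst₂ (λ x y → T (r x y)) (toℕ-fᶠ i) (toℕ-fᶠ j) (proj₁ (rep (fᶠ i) (fᶠ j)) p))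

  image : ∀ {x y} → x R.≺ y → (∃[ i ] fᶠ i ≡ x) × (∃[ j ] fᶠ j ≡ y)
  image {x} {y} x≺y =
    let ((i , p) , (j , s)) = T-does⁻ (T? (r (toℕ x) (toℕ y)) →-dec
          (Fin.any? (λ i → f i ℕ.≟ toℕ x) ×-dec Fin.any? (λ j → f j ℕ.≟ toℕ y)))
          (allᵇ⁻ n _ (allᵇ⁻ n _ (proj₂ t₄) x) y) (proj₁ (rep x y) x≺y)
    in (i , Fin.toℕ-injective (trans (toℕ-fᶠ i) p)) , (j , Fin.toℕ-injective (trans (toℕ-fᶠ j) s))

-- The cuts from the chain to the diamond.

-- A pair (m , a) is the cut at m with the antichain {a}, and labels lists the
-- positions of b₁, …, b₄, c₁₂, …, c₃₄, t₁, t₂, t₃ in the chain; every other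
-- position is cut off once. Cuts at m > 33 only serve to make a maximal. The
-- positions 24, 25, 29, 30, 32, 33, two above each tᵢ, separate each c from the
-- other c's and from the tᵢ not above it. The final ten cuts separate the b's
-- from each other and from the c's not above them; before that, the cuts at 21,
-- 22, 23, 27, 28 detach those of their positions that still lie below t₁ or t₂.
program : Program
program =
  (57 , 56) ∷ (56 , 21) ∷ (55 , 22) ∷ (54 , 23) ∷ (53 , 5) ∷ (52 , 6) ∷
  (51 , 24) ∷ (24 , 4) ∷ (50 , 11) ∷ (49 , 8) ∷ (48 , 25) ∷ (25 , 7) ∷
  (47 , 10) ∷ (46 , 27) ∷ (45 , 28) ∷ (44 , 20) ∷ (43 , 29) ∷ (29 , 9) ∷
  (42 , 13) ∷ (41 , 16) ∷ (40 , 30) ∷ (30 , 12) ∷ (39 , 15) ∷ (38 , 26) ∷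
  (37 , 32) ∷ (32 , 14) ∷ (36 , 18) ∷ (35 , 19) ∷ (34 , 33) ∷ (33 , 17) ∷
  (27 , 18) ∷ (28 , 19) ∷ (21 , 15) ∷ (22 , 13) ∷ (23 , 16) ∷ (19 , 2) ∷
  (18 , 1) ∷ (16 , 3) ∷ (15 , 0) ∷ (13 , 1) ∷ (11 , 2) ∷ (10 , 0) ∷
  (8 , 3) ∷ (6 , 1) ∷ (5 , 0) ∷ []

labels : Vec ℕ 13
labels = 0 ∷ 1 ∷ 2 ∷ 3 ∷ 7 ∷ 12 ∷ 17 ∷ 14 ∷ 9 ∷ 4 ∷ 20 ∷ 26 ∷ 31 ∷ []

theorem1p5 : P◇ ⇝ chain 59
-- The cut `(58 , 57)` precedes the 45 in `program`; nothing lies strictly between its two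
-- positions, so it merely isolates the top. The first `tt` has `valid` evaluated, the second
-- `isCore`.
theorem1p5 = embedding P◇ (Vec.lookup labels) (cuts-chain 59 58 57 program tt) tt
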